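{- Let $\mathcal U=[-\underline{\zeta},\overline{\zeta}]$ be an uncertainty set that is the same in every round, where $\underline{\zeta},\overline{\zeta}>0$ are polynomials in the number of rounds $\tau$. Let the payoff function $g$ be monotonically non-decreasing with $g(0)=0$ and Lipschitz continuous with constant $L$, i.e. $|g(y)-g(x)|\le L|y-x|$ for all real $x,y$. Let $\delta$ be an arbitrary constant, and consider using the multinomial tree approximation algorithm with discretization parameter $\epsilon$ to find the European price upper bound at initial price $S_0$. When $\epsilon=c\,\delta^2/(L^2\tau^2)$ for some constant $c$, the algorithm gives a $\hat g_0(S_0)$ such that $$g_0(S_0)-\delta S_0\le \hat g_0(S_0)\le g_0(S_0),$$ where $g_0(S_0)$ is the exact price upper bound.
   Context: Exact value functions: $g_\tau(x)=g(x)$ and, for $t=\tau-1,\dots,0$, $$g_t(x)=\min_{\Delta}\max_{R\in\mathcal U}\bigl[g_{t+1}(x(1+R))-R\Delta\bigr].$$ The number $g_0(S_0)$ is the no-arbitrage upper bound of the price of the European option with payoff $g$ in the $\tau$-round hedging game with initial price $S_0$ and uncertainty set $\mathcal U$ for the return in each round. Multinomial tree approximation: the set $\mathcal U$ is replaced by the discrete set $\hat{\mathcal U}=\{ -\underline{\zeta},-\underline{\zeta}+\epsilon,-\underline{\zeta}+2\epsilon,\dots,\overline{\zeta}\}$, where $\epsilon$ is a parameter of the algorithm. Put $\hat g_\tau(x)=g(x)$ and, for $t=\tau-1,\dots,0$, let $\hat g_t(x)$ be the optimal value of the linear program in the variables $p,\Delta$: minimize $p$ subject to $\hat g_{t+1}(x(1+r))-r\Delta\le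 p$ for all $r\in\hat{\mathcal U}$.
   Formalization: Added: returns are at least −100 % (lower end of the uncertainty set ≥ −1; for larger possible losses prices turn negative and the bound fails for every constant c), and δ > 0, L > 0, S₀ ≥ 0, without which ε or the two-sided bound makes no sense. -}

module Defs where

open import Data.Nat as ℕ using (ℕ; zero; suc)
import Data.Nat.Properties as ℕₚ
import Data.Integer as ℤ
open import Data.Rational as ℚ using (ℚ; 0ℚ; 1ℚ; ½)
import Data.Rational.Properties as ℚₚ
open import Data.Rational.Solver using (module +-*-Solver)
open import Data.List using (List; []; _∷_)
open import Data.Product using (Σ; ∃-syntax; _×_; _,_)
open import Data.Sum using (_⊎_; inj₁; inj₂)
open import Relation.Binary.PropositionalEquality
  using (_≡_; refl; sym; trans; cong; cong₂; subst)

-- Real numbers: Cauchy sequences of rationals, with setoid equality _≈_.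
-- The ring operations act termwise.

IsCauchy : (ℕ → ℚ) → Set
IsCauchy s = ∀ η → 0ℚ ℚ.< η →
  ∃[ N ] ∀ m n → N ℕ.≤ m → N ℕ.≤ n → ℚ.∣ s m ℚ.- s n ∣ ℚ.≤ η

record ℝ : Set where
  constructor real
  field
    seq    : ℕ → ℚ
    cauchy : IsCauchy seq

open ℝ public

infix  4 _≤_ _<_ _≈_
infixl 6 _+_ _-_
infixl 7 _*_
infix  8 -_

_≤_ : ℝ → ℝ → Set
x ≤ y = ∀ η → 0ℚ ℚ.< η → ∃[ N ] ∀ n → N ℕ.≤ n → seq x n ℚ.≤ seq y n ℚ.+ η

_<_ : ℝ → ℝ → Set
x < y = ∃[ η ] (0ℚ ℚ.< η) × ∃[ N ] ∀ n → N ℕ.≤ n → seq x n ℚ.+ η ℚ.≤ seq y n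

_≈_ : ℝ → ℝ → Set
x ≈ y = (x ≤ y) × (y ≤ x)

private
  half-pos : ∀ {η} → 0ℚ ℚ.< η → 0ℚ ℚ.< ½ ℚ.* η
  half-pos {η} 0<η =
    subst (ℚ._< ½ ℚ.* η) (ℚₚ.*-zeroʳ ½) (ℚₚ.*-monoʳ-<-pos ½ 0<η)

  half+half : ∀ η → ½ ℚ.* η ℚ.+ ½ ℚ.* η ≡ η
  half+half η = trans (sym (ℚₚ.*-distribʳ-+ η ½ ½)) (ℚₚ.*-identityˡ η)

  positive-* : ∀ {p q} → 0ℚ ℚ.< p → 0ℚ ℚ.< q → 0ℚ ℚ.< p ℚ.* q
  positive-* {p} {q} 0<p 0<q =
    ℚₚ.positive⁻¹ (p ℚ.* q)
      {{ℚₚ.pos*pos⇒pos p {{ℚ.positive 0<p}} q {{ℚ.positive 0<q}}}}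

fromℚ : ℚ → ℝ
fromℚ q = real (λ _ → q) λ η 0<η → 0 , λ _ _ _ _ →
  subst (ℚ._≤ η) (cong ℚ.∣_∣ (sym (ℚₚ.+-inverseʳ q))) (ℚₚ.<⇒≤ 0<η)

0ℝ 1ℝ : ℝ
0ℝ = fromℚ 0ℚ
1ℝ = fromℚ 1ℚ

fromℕ : ℕ → ℝ
fromℕ n = fromℚ (ℤ.+ n ℚ./ 1)

_+_ : ℝ → ℝ → ℝ
x + y = real (λ n → seq x n ℚ.+ seq y n) λ η 0<η →
  let (M , p) = cauchy x (½ ℚ.* η) (half-pos 0<η)
      (N , q) = cauchy y (½ ℚ.* η) (half-pos 0<η)
  in M ℕ.⊔ N , λ m n m≥ n≥ → begin
    ℚ.∣ (seq x m ℚ.+ seq y m) ℚ.- (seq x n ℚ.+ seq y n) ∣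
      ≡⟨ cong ℚ.∣_∣ (rearrange (seq x m) (seq y m) (seq x n) (seq y n)) ⟩
    ℚ.∣ (seq x m ℚ.- seq x n) ℚ.+ (seq y m ℚ.- seq y n) ∣
      ≤⟨ ℚₚ.∣p+q∣≤∣p∣+∣q∣ (seq x m ℚ.- seq x n) (seq y m ℚ.- seq y n) ⟩
    ℚ.∣ seq x m ℚ.- seq x n ∣ ℚ.+ ℚ.∣ seq y m ℚ.- seq y n ∣
      ≤⟨ ℚₚ.+-mono-≤
           (p m n (ℕₚ.m⊔n≤o⇒m≤o M N m≥) (ℕₚ.m⊔n≤o⇒m≤o M N n≥))
           (q m n (ℕₚ.m⊔n≤o⇒n≤o M N m≥) (ℕₚ.m⊔n≤o⇒n≤o M N n≥)) ⟩
    ½ ℚ.* η ℚ.+ ½ ℚ.* η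
      ≡⟨ half+half η ⟩
    η ∎
  where
    open ℚₚ.≤-Reasoning
    rearrange : ∀ a b c d →
      (a ℚ.+ b) ℚ.- (c ℚ.+ d) ≡ (a ℚ.- c) ℚ.+ (b ℚ.- d)
    rearrange = solve 4 (λ a b c d →
      (a :+ b) :- (c :+ d) := (a :- c) :+ (b :- d)) refl
      where open +-*-Solver

-_ : ℝ → ℝ
- x = real (λ n → ℚ.- seq x n) λ η 0<η →
  let (N , p) = cauchy x η 0<η in N , λ m n m≥ n≥ →
    subst (ℚ._≤ η) (flip (seq x m) (seq x n)) (p m n m≥ n≥)
  where
    flip : ∀ a b → ℚ.∣ a ℚ.- b ∣ ≡ ℚ.∣ (ℚ.- a) ℚ.- (ℚ.- b) ∣
    flip a b = trans (sym (ℚₚ.∣-p∣≡∣p∣ (a ℚ.- b)))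
                     (cong ℚ.∣_∣ (ℚₚ.neg-distrib-+ a (ℚ.- b)))

_-_ : ℝ → ℝ → ℝ
x - y = x + (- y)

∣_∣ : ℝ → ℝ
∣ x ∣ = real (λ n → ℚ.∣ seq x n ∣) λ η 0<η →
  let (N , p) = cauchy x η 0<η in N , λ m n m≥ n≥ →
    ℚₚ.≤-trans (reverse-triangle (seq x m) (seq x n)) (p m n m≥ n≥)
  where
    open ℚₚ.≤-Reasoning
    one-sided : ∀ a b → ℚ.∣ a ∣ ℚ.- ℚ.∣ b ∣ ℚ.≤ ℚ.∣ a ℚ.- b ∣
    one-sided a b = begin
      ℚ.∣ a ∣ ℚ.- ℚ.∣ b ∣
        ≡⟨ cong (λ z → ℚ.∣ z ∣ ℚ.- ℚ.∣ b ∣)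
             (solve 2 (λ u v → u := (u :- v) :+ v) refl a b) ⟩
      ℚ.∣ (a ℚ.- b) ℚ.+ b ∣ ℚ.- ℚ.∣ b ∣
        ≤⟨ ℚₚ.+-monoˡ-≤ (ℚ.- ℚ.∣ b ∣) (ℚₚ.∣p+q∣≤∣p∣+∣q∣ (a ℚ.- b) b) ⟩
      (ℚ.∣ a ℚ.- b ∣ ℚ.+ ℚ.∣ b ∣) ℚ.- ℚ.∣ b ∣
        ≡⟨ solve 2 (λ u v → (u :+ v) :- v := u) refl ℚ.∣ a ℚ.- b ∣ ℚ.∣ b ∣ ⟩
      ℚ.∣ a ℚ.- b ∣ ∎
      where open +-*-Solver
    ∣-∣-sym : ∀ a b → ℚ.∣ a ℚ.- b ∣ ≡ ℚ.∣ b ℚ.- a ∣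
    ∣-∣-sym a b = trans (sym (ℚₚ.∣-p∣≡∣p∣ (a ℚ.- b)))
      (cong ℚ.∣_∣ (solve 2 (λ u v → :- (u :- v) := v :- u) refl a b))
      where open +-*-Solver
    reverse-triangle : ∀ a b → ℚ.∣ ℚ.∣ a ∣ ℚ.- ℚ.∣ b ∣ ∣ ℚ.≤ ℚ.∣ a ℚ.- b ∣
    reverse-triangle a b with ℚₚ.∣p∣≡p∨∣p∣≡-p (ℚ.∣ a ∣ ℚ.- ℚ.∣ b ∣)
    ... | inj₁ eq = ℚₚ.≤-trans (ℚₚ.≤-reflexive eq) (one-sided a b)
    ... | inj₂ eq = begin
      ℚ.∣ ℚ.∣ a ∣ ℚ.- ℚ.∣ b ∣ ∣  ≡⟨ eq ⟩
      ℚ.- (ℚ.∣ a ∣ ℚ.- ℚ.∣ b ∣)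
        ≡⟨ solve 2 (λ u v → :- (u :- v) := v :- u) refl ℚ.∣ a ∣ ℚ.∣ b ∣ ⟩
      ℚ.∣ b ∣ ℚ.- ℚ.∣ a ∣        ≤⟨ one-sided b a ⟩
      ℚ.∣ b ℚ.- a ∣              ≡⟨ ∣-∣-sym b a ⟩
      ℚ.∣ a ℚ.- b ∣              ∎
      where open +-*-Solver

-- Only eventual bounds are needed, since Cauchyness only concerns tails.
bounded : ∀ x → ∃[ B ] (0ℚ ℚ.< B) × ∃[ N ] ∀ n → N ℕ.≤ n → ℚ.∣ seq x n ∣ ℚ.≤ B
bounded x =
  let (N , p) = cauchy x 1ℚ 0<1
      B       = 1ℚ ℚ.+ ℚ.∣ seq x N ∣
  in B , ℚₚ.<-≤-trans 0<1 (1≤ (seq x N)) , N , λ n n≥ →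
    begin
      ℚ.∣ seq x n ∣
        ≡⟨ cong ℚ.∣_∣ (solve 2 (λ u v → u := (u :- v) :+ v) refl (seq x n) (seq x N)) ⟩
      ℚ.∣ (seq x n ℚ.- seq x N) ℚ.+ seq x N ∣
        ≤⟨ ℚₚ.∣p+q∣≤∣p∣+∣q∣ (seq x n ℚ.- seq x N) (seq x N) ⟩
      ℚ.∣ seq x n ℚ.- seq x N ∣ ℚ.+ ℚ.∣ seq x N ∣
        ≤⟨ ℚₚ.+-monoˡ-≤ ℚ.∣ seq x N ∣ (p n N n≥ ℕₚ.≤-refl) ⟩
      1ℚ ℚ.+ ℚ.∣ seq x N ∣ ∎
  where
    open ℚₚ.≤-Reasoning
    open +-*-Solver
    0<1 : 0ℚ ℚ.< 1ℚ
    0<1 = ℚₚ.positive⁻¹ 1ℚ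
    1≤ : ∀ q → 1ℚ ℚ.≤ 1ℚ ℚ.+ ℚ.∣ q ∣
    1≤ q = ℚₚ.≤-trans (ℚₚ.≤-reflexive (sym (ℚₚ.+-identityʳ 1ℚ)))
                      (ℚₚ.+-monoʳ-≤ 1ℚ (ℚₚ.0≤∣p∣ q))

private
  -- b · (η / 2b) = η / 2
  share : ℚ → (b : ℚ) → 0ℚ ℚ.< b → ℚ
  share η b 0<b = ½ ℚ.* η ℚ.* ℚ.1/_ b {{ℚₚ.pos⇒nonZero b {{ℚ.positive 0<b}}}}

  share-pos : ∀ {η} b (0<b : 0ℚ ℚ.< b) → 0ℚ ℚ.< η → 0ℚ ℚ.< share η b 0<b
  share-pos b 0<b 0<η = positive-* (half-pos 0<η)
    (ℚₚ.positive⁻¹ _ {{ℚₚ.1/pos⇒pos b {{ℚ.positive 0<b}}}})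

  share-* : ∀ η b (0<b : 0ℚ ℚ.< b) → share η b 0<b ℚ.* b ≡ ½ ℚ.* η
  share-* η b 0<b =
    trans (ℚₚ.*-assoc (½ ℚ.* η) _ b)
      (trans (cong (½ ℚ.* η ℚ.*_)
                (ℚₚ.*-inverseˡ b {{ℚₚ.pos⇒nonZero b {{ℚ.positive 0<b}}}}))
             (ℚₚ.*-identityʳ (½ ℚ.* η)))

  *-mono-≤-nonNeg : ∀ {a b c d} → 0ℚ ℚ.≤ a → 0ℚ ℚ.≤ d →
    a ℚ.≤ b → c ℚ.≤ d → a ℚ.* c ℚ.≤ b ℚ.* d
  *-mono-≤-nonNeg {a} {b} {c} {d} 0≤a 0≤d a≤b c≤d = ℚₚ.≤-trans
    (ℚₚ.*-monoˡ-≤-nonNeg a {{ℚ.nonNegative 0≤a}} c≤d)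
    (ℚₚ.*-monoʳ-≤-nonNeg d {{ℚ.nonNegative 0≤d}} a≤b)

_*_ : ℝ → ℝ → ℝ
x * y = real (λ n → seq x n ℚ.* seq y n) λ η 0<η →
  let (A , 0<A , K , ∣x∣≤A) = bounded x
      (B , 0<B , J , ∣y∣≤B) = bounded y
      (M , p) = cauchy x (share η B 0<B) (share-pos B 0<B 0<η)
      (N , q) = cauchy y (share η A 0<A) (share-pos A 0<A 0<η)
      KJ = K ℕ.⊔ J
      MN = M ℕ.⊔ N
  in KJ ℕ.⊔ MN , λ m n m≥ n≥ →
    let mKJ = ℕₚ.m⊔n≤o⇒m≤o KJ MN m≥
        mMN = ℕₚ.m⊔n≤o⇒n≤o KJ MN m≥
        nKJ = ℕₚ.m⊔n≤o⇒m≤o KJ MN n≥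
        nMN = ℕₚ.m⊔n≤o⇒n≤o KJ MN n≥
        x₁ = seq x m ; x₂ = seq x n ; y₁ = seq y m ; y₂ = seq y n
    in begin
    ℚ.∣ x₁ ℚ.* y₁ ℚ.- x₂ ℚ.* y₂ ∣
      ≡⟨ cong ℚ.∣_∣ (rearrange x₁ y₁ x₂ y₂) ⟩
    ℚ.∣ (x₁ ℚ.- x₂) ℚ.* y₁ ℚ.+ (y₁ ℚ.- y₂) ℚ.* x₂ ∣
      ≤⟨ ℚₚ.∣p+q∣≤∣p∣+∣q∣ ((x₁ ℚ.- x₂) ℚ.* y₁) ((y₁ ℚ.- y₂) ℚ.* x₂) ⟩
    ℚ.∣ (x₁ ℚ.- x₂) ℚ.* y₁ ∣ ℚ.+ ℚ.∣ (y₁ ℚ.- y₂) ℚ.* x₂ ∣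
      ≡⟨ cong₂ ℚ._+_ (ℚₚ.∣p*q∣≡∣p∣*∣q∣ (x₁ ℚ.- x₂) y₁)
                     (ℚₚ.∣p*q∣≡∣p∣*∣q∣ (y₁ ℚ.- y₂) x₂) ⟩
    ℚ.∣ x₁ ℚ.- x₂ ∣ ℚ.* ℚ.∣ y₁ ∣ ℚ.+ ℚ.∣ y₁ ℚ.- y₂ ∣ ℚ.* ℚ.∣ x₂ ∣
      ≤⟨ ℚₚ.+-mono-≤
           (*-mono-≤-nonNeg (ℚₚ.0≤∣p∣ (x₁ ℚ.- x₂)) (ℚₚ.<⇒≤ 0<B)
             (p m n (ℕₚ.m⊔n≤o⇒m≤o M N mMN) (ℕₚ.m⊔n≤o⇒m≤o M N nMN))
             (∣y∣≤B m (ℕₚ.m⊔n≤o⇒n≤o K J mKJ)))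
           (*-mono-≤-nonNeg (ℚₚ.0≤∣p∣ (y₁ ℚ.- y₂)) (ℚₚ.<⇒≤ 0<A)
             (q m n (ℕₚ.m⊔n≤o⇒n≤o M N mMN) (ℕₚ.m⊔n≤o⇒n≤o M N nMN))
             (∣x∣≤A n (ℕₚ.m⊔n≤o⇒m≤o K J nKJ))) ⟩
    share η B 0<B ℚ.* B ℚ.+ share η A 0<A ℚ.* A
      ≡⟨ cong₂ ℚ._+_ (share-* η B 0<B) (share-* η A 0<A) ⟩
    ½ ℚ.* η ℚ.+ ½ ℚ.* η
      ≡⟨ half+half η ⟩
    η ∎
  where
    open ℚₚ.≤-Reasoning
    rearrange : ∀ a b c d →
      a ℚ.* b ℚ.- c ℚ.* d ≡ (a ℚ.- c) ℚ.* b ℚ.+ (b ℚ.- d) ℚ.* c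
    rearrange = solve 4 (λ a b c d →
      a :* b :- c :* d := (a :- c) :* b :+ (b :- d) :* c) refl
      where open +-*-Solver

private
  recipℚ : (q : ℚ) → 0ℚ ℚ.< q → ℚ
  recipℚ q 0<q = ℚ.1/_ q {{ℚₚ.pos⇒nonZero q {{ℚ.positive 0<q}}}}

  recipℚ-* : ∀ q (0<q : 0ℚ ℚ.< q) → q ℚ.* recipℚ q 0<q ≡ 1ℚ
  recipℚ-* q 0<q = ℚₚ.*-inverseʳ q {{ℚₚ.pos⇒nonZero q {{ℚ.positive 0<q}}}}

  recip-diff : ∀ {e} a b (0<e : 0ℚ ℚ.< e) (0<a : 0ℚ ℚ.< a) (0<b : 0ℚ ℚ.< b) →
    e ℚ.≤ a → e ℚ.≤ b →
    e ℚ.* e ℚ.* ℚ.∣ recipℚ a 0<a ℚ.- recipℚ b 0<b ∣ ℚ.≤ ℚ.∣ a ℚ.- b ∣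
  recip-diff {e} a b 0<e 0<a 0<b e≤a e≤b = begin
    e ℚ.* e ℚ.* ℚ.∣ u ℚ.- v ∣
      ≤⟨ ℚₚ.*-monoʳ-≤-nonNeg ℚ.∣ u ℚ.- v ∣
           {{ℚₚ.∣-∣-nonNeg (u ℚ.- v)}}
           (*-mono-≤-nonNeg (ℚₚ.<⇒≤ 0<e) (ℚₚ.<⇒≤ 0<b) e≤a e≤b) ⟩
    a ℚ.* b ℚ.* ℚ.∣ u ℚ.- v ∣
      ≡⟨ cong (ℚ._* ℚ.∣ u ℚ.- v ∣)
           (sym (ℚₚ.0≤p⇒∣p∣≡p (ℚₚ.<⇒≤ (positive-* 0<a 0<b)))) ⟩
    ℚ.∣ a ℚ.* b ∣ ℚ.* ℚ.∣ u ℚ.- v ∣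
      ≡⟨ sym (ℚₚ.∣p*q∣≡∣p∣*∣q∣ (a ℚ.* b) (u ℚ.- v)) ⟩
    ℚ.∣ a ℚ.* b ℚ.* (u ℚ.- v) ∣
      ≡⟨ cong ℚ.∣_∣ (rearrange a b u v) ⟩
    ℚ.∣ (a ℚ.* u) ℚ.* b ℚ.- (b ℚ.* v) ℚ.* a ∣
      ≡⟨ cong₂ (λ s t → ℚ.∣ s ℚ.* b ℚ.- t ℚ.* a ∣)
           (recipℚ-* a 0<a) (recipℚ-* b 0<b) ⟩
    ℚ.∣ 1ℚ ℚ.* b ℚ.- 1ℚ ℚ.* a ∣
      ≡⟨ cong₂ (λ s t → ℚ.∣ s ℚ.- t ∣) (ℚₚ.*-identityˡ b) (ℚₚ.*-identityˡ a) ⟩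
    ℚ.∣ b ℚ.- a ∣
      ≡⟨ sym (ℚₚ.∣-p∣≡∣p∣ (b ℚ.- a)) ⟩
    ℚ.∣ ℚ.- (b ℚ.- a) ∣
      ≡⟨ cong ℚ.∣_∣ (swap a b) ⟩
    ℚ.∣ a ℚ.- b ∣ ∎
    where
      open ℚₚ.≤-Reasoning
      open +-*-Solver
      rearrange : ∀ a b u v →
        a ℚ.* b ℚ.* (u ℚ.- v) ≡ (a ℚ.* u) ℚ.* b ℚ.- (b ℚ.* v) ℚ.* a
      rearrange = solve 4 (λ a b u v →
        a :* b :* (u :- v) := (a :* u) :* b :- (b :* v) :* a) refl
      swap : ∀ a b → ℚ.- (b ℚ.- a) ≡ a ℚ.- b
      swap = solve 2 (λ a b → :- (b :- a) := a :- b) refl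
      u = recipℚ a 0<a
      v = recipℚ b 0<b

-- If x is eventually at least e > 0, the n-th term is 1 / max(xₙ, e), so that
-- finitely many vanishing or negative terms of x are harmless.
recip : (x : ℝ) → 0ℝ < x → ℝ
recip x (e , 0<e , N , below) =
  real (λ n → recipℚ (clip n) (clip-pos n)) λ η 0<η →
    let (M , p) = cauchy x (e ℚ.* e ℚ.* η) (positive-* 0<ee 0<η)
    in N ℕ.⊔ M , λ m n m≥ n≥ →
      ℚₚ.*-cancelˡ-≤-pos (e ℚ.* e) {{ℚ.positive 0<ee}}
        (ℚₚ.≤-trans
          (recip-diff (clip m) (clip n) 0<e (clip-pos m) (clip-pos n)
            (ℚₚ.p≤q⊔p (seq x m) e) (ℚₚ.p≤q⊔p (seq x n) e))
          (ℚₚ.≤-trans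
            (ℚₚ.≤-reflexive (cong₂ (λ s t → ℚ.∣ s ℚ.- t ∣)
              (clip-id m (ℕₚ.m⊔n≤o⇒m≤o N M m≥))
              (clip-id n (ℕₚ.m⊔n≤o⇒m≤o N M n≥))))
            (p m n (ℕₚ.m⊔n≤o⇒n≤o N M m≥) (ℕₚ.m⊔n≤o⇒n≤o N M n≥))))
  where
    clip : ℕ → ℚ
    clip n = seq x n ℚ.⊔ e
    clip-pos : ∀ n → 0ℚ ℚ.< clip n
    clip-pos n = ℚₚ.<-≤-trans 0<e (ℚₚ.p≤q⊔p (seq x n) e)
    clip-id : ∀ n → N ℕ.≤ n → clip n ≡ seq x n
    clip-id n n≥ = ℚₚ.p≥q⇒p⊔q≡p
      (ℚₚ.≤-trans (ℚₚ.≤-reflexive (sym (ℚₚ.+-identityˡ e))) (below n n≥))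
    0<ee : 0ℚ ℚ.< e ℚ.* e
    0<ee = positive-* 0<e 0<e

*-pos : ∀ {x y} → 0ℝ < x → 0ℝ < y → 0ℝ < x * y
*-pos {x} {y} (d , 0<d , M , p) (e , 0<e , N , q) =
  d ℚ.* e , positive-* 0<d 0<e , M ℕ.⊔ N , λ n n≥ →
    let d≤x = ℚₚ.≤-trans (ℚₚ.≤-reflexive (sym (ℚₚ.+-identityˡ d)))
                (p n (ℕₚ.m⊔n≤o⇒m≤o M N n≥))
        e≤y = ℚₚ.≤-trans (ℚₚ.≤-reflexive (sym (ℚₚ.+-identityˡ e)))
                (q n (ℕₚ.m⊔n≤o⇒n≤o M N n≥))
    in ℚₚ.≤-trans (ℚₚ.≤-reflexive (ℚₚ.+-identityˡ (d ℚ.* e)))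
         (*-mono-≤-nonNeg (ℚₚ.<⇒≤ 0<d)
           (ℚₚ.≤-trans (ℚₚ.<⇒≤ 0<e) e≤y) d≤x e≤y)

fromℕ-pos : ∀ n .{{_ : ℕ.NonZero n}} → 0ℝ < fromℕ n
fromℕ-pos n = q , ℚₚ.positive⁻¹ q {{ℚₚ.normalize-pos n 1}} , 0 ,
              λ _ _ → ℚₚ.≤-reflexive (ℚₚ.+-identityˡ q)
  where q = ℤ.+ n ℚ./ 1

-- Coefficients in ascending order of degree.
evalPoly : List ℝ → ℝ → ℝ
evalPoly []       x = 0ℝ
evalPoly (a ∷ as) x = a + x * evalPoly as x

Monotone : (ℝ → ℝ) → Set
Monotone g = ∀ x y → x ≤ y → g x ≤ g y

LipschitzWith : ℝ → (ℝ → ℝ) → Set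
LipschitzWith L g = ∀ x y → ∣ g y - g x ∣ ≤ L * ∣ y - x ∣

IsMaximum : (S : ℝ → Set) (f : ℝ → ℝ) (v : ℝ) → Set
IsMaximum S f v = (∃[ R ] S R × f R ≈ v) × (∀ R → S R → f R ≤ v)

IsMinimum : (f : ℝ → ℝ) (v : ℝ) → Set
IsMinimum f v = (∃[ Δ ] f Δ ≈ v) × (∀ Δ → v ≤ f Δ)

IsMinMax : (S : ℝ → Set) (f : ℝ → ℝ → ℝ) (v : ℝ) → Set
IsMinMax S f v =
  Σ (ℝ → ℝ) λ M → (∀ Δ → IsMaximum S (f Δ) (M Δ)) × IsMinimum M v

interval : (ζ₋ ζ₊ : ℝ) → ℝ → Set
interval ζ₋ ζ₊ R = (- ζ₋ ≤ R) × (R ≤ ζ₊)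

-- The recursion determines G t, for t ≤ τ, uniquely up to _≈_; later G t are junk.
IsValueFunction : (τ : ℕ) (U : ℝ → Set) (g : ℝ → ℝ) (G : ℕ → ℝ → ℝ) → Set
IsValueFunction τ U g G =
  (∀ x → G τ x ≈ g x) ×
  (∀ t → t ℕ.< τ → ∀ x →
     IsMinMax U (λ Δ R → G (suc t) (x * (1ℝ + R)) - R * Δ) (G t x))

-- {-ζ₋, -ζ₋ + ε, -ζ₋ + 2ε, …, ζ₊}.  The right endpoint always belongs to the
-- grid, also when ε does not divide ζ₋ + ζ₊ (the last gap is then shorter).
grid : (ζ₋ ζ₊ ε : ℝ) → ℝ → Set
grid ζ₋ ζ₊ ε r =
  (∃[ k ] (r ≈ - ζ₋ + fromℕ k * ε) × (r ≤ ζ₊)) ⊎ (r ≈ ζ₊)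

Feasible : (S : ℝ → Set) (f : ℝ → ℝ) (p Δ : ℝ) → Set
Feasible S f p Δ = ∀ r → S r → f r - r * Δ ≤ p

IsOptimalValue : (S : ℝ → Set) (f : ℝ → ℝ) (v : ℝ) → Set
IsOptimalValue S f v =
  (∃[ Δ ] Feasible S f v Δ) × (∀ p Δ → Feasible S f p Δ → v ≤ p)

IsTreeApproximation : (τ : ℕ) (Û : ℝ → Set) (g : ℝ → ℝ) (Ĝ : ℕ → ℝ → ℝ) → Set
IsTreeApproximation τ Û g Ĝ =
  (∀ x → Ĝ τ x ≈ g x) ×
  (∀ t → t ℕ.< τ → ∀ x →
     IsOptimalValue Û (λ r → Ĝ (suc t) (x * (1ℝ + r))) (Ĝ t x))

-- c δ² / (L² τ²)
stepSize : (c δ L : ℝ) → 0ℝ < L → (τ : ℕ) → .{{ℕ.NonZero τ}} → ℝ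
stepSize c δ L 0<L τ =
  (c * (δ * δ)) *
  recip ((L * L) * (fromℕ τ * fromℕ τ))
        (*-pos {L * L} {fromℕ τ * fromℕ τ}
          (*-pos {L} {L} 0<L 0<L)
          (*-pos {fromℕ τ} {fromℕ τ} (fromℕ-pos τ) (fromℕ-pos τ)))

{-# OPTIONS --safe #-}

-- An exact price is the least capital v for which some hedge Δ gives
-- G_{t+1}(x (1 + r)) ≤ v + r Δ for all returns r, so it solves the same kind of
-- program as Ĝ, over the interval instead of the grid; fewer constraints give Ĝ ≤ G.
-- Since 1 + r ≥ 0, the constant L is a Lipschitz constant for every G_t.  A hedge valid
-- at two grid points at distance ≤ ε is valid between them at the extra cost L ε x;
-- an error k x carried from round t + 1 is hedged exactly by k x units of stock, so the
-- total error is at most τ L ε S₀.  With c = 1 and δ ≤ L this is δ² S₀ / (L τ) ≤ δ S₀.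
-- If δ > L, already G₀(S₀) ≤ L S₀ ≤ δ S₀ and Ĝ₀(S₀) ≥ 0.
module Submission where

open import Defs
open import Data.Nat as ℕ using (ℕ; zero; suc; NonZero)
import Data.Nat.Properties as ℕₚ
import Data.Integer as ℤ
import Data.Integer.Properties as ℤₚ
open import Data.Rational as ℚ using (ℚ; 0ℚ; 1ℚ; ½)
import Data.Rational.Properties as ℚₚ
import Data.Rational.Unnormalised as ℚᵘ
import Data.Rational.Unnormalised.Properties as ℚᵘₚ
open import Data.Rational.Solver using (module +-*-Solver)
open import Data.List using (List)
open import Data.Product using (∃-syntax; _×_; _,_; proj₁; proj₂)
open import Data.Sum using (inj₁; inj₂)
open import Relation.Nullary using (¬_; Dec; yes; no; contradiction)
open import Relation.Binary.PropositionalEquality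
  using (_≡_; refl; sym; trans; cong; subst; subst₂)
open +-*-Solver using (solve; _:+_; _:*_; _:-_; :-_; _:=_; con)

-- Rational arithmetic

0<½* : ∀ {η} → 0ℚ ℚ.< η → 0ℚ ℚ.< ½ ℚ.* η
0<½* {η} 0<η = subst (ℚ._< ½ ℚ.* η) (ℚₚ.*-zeroʳ ½) (ℚₚ.*-monoʳ-<-pos ½ 0<η)

0≤p*q : ∀ {p q} → 0ℚ ℚ.≤ p → 0ℚ ℚ.≤ q → 0ℚ ℚ.≤ p ℚ.* q
0≤p*q {p} {q} 0≤p 0≤q =
  ℚₚ.≤-trans (ℚₚ.≤-reflexive (sym (ℚₚ.*-zeroʳ p)))
    (ℚₚ.*-monoˡ-≤-nonNeg p {{ℚ.nonNegative 0≤p}} 0≤q)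

0≤q-p : ∀ {p q} → p ℚ.≤ q → 0ℚ ℚ.≤ q ℚ.- p
0≤q-p {p} {q} p≤q = subst (ℚ._≤ q ℚ.- p) (ℚₚ.+-inverseʳ p) (ℚₚ.+-monoˡ-≤ (ℚ.- p) p≤q)

0≤q-p⇒p≤q : ∀ {p q} → 0ℚ ℚ.≤ q ℚ.- p → p ℚ.≤ q
0≤q-p⇒p≤q {p} {q} h = subst₂ ℚ._≤_ (ℚₚ.+-identityˡ p)
  (solve 2 (λ p q → (q :- p) :+ p := q) refl p q) (ℚₚ.+-monoˡ-≤ p h)

≤-rearrange : ∀ {p q r s} → p ℚ.≤ q → s ℚ.- r ≡ q ℚ.- p → r ℚ.≤ s
≤-rearrange p≤q eq = 0≤q-p⇒p≤q (subst (0ℚ ℚ.≤_) (sym eq) (0≤q-p p≤q))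

p≤∣p∣ : ∀ p → p ℚ.≤ ℚ.∣ p ∣
p≤∣p∣ p with ℚₚ.≤-total 0ℚ p
... | inj₁ 0≤p = ℚₚ.≤-reflexive (sym (ℚₚ.0≤p⇒∣p∣≡p 0≤p))
... | inj₂ p≤0 = ℚₚ.≤-trans p≤0 (ℚₚ.0≤∣p∣ p)

∣p-q∣≤r⇒p≤q+r : ∀ {p q r} → ℚ.∣ p ℚ.- q ∣ ℚ.≤ r → p ℚ.≤ q ℚ.+ r
∣p-q∣≤r⇒p≤q+r {p} {q} {r} h = ≤-rearrange (ℚₚ.≤-trans (p≤∣p∣ (p ℚ.- q)) h)
  (solve 3 (λ p q r → q :+ r :- p := r :- (p :- q)) refl p q r)

-- `_/_` reduces a fraction by a gcd, which is stuck on a variable `n`. The identity is therefore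
-- checked on unnormalised fractions and transported back.
+n/1-suc : ∀ n → ℤ.+ suc n ℚ./ 1 ≡ 1ℚ ℚ.+ ℤ.+ n ℚ./ 1
+n/1-suc n = ℚₚ.toℚᵘ-injective (begin
  ℚ.toℚᵘ (ℤ.+ suc n ℚ./ 1)                ≈⟨ ℚₚ.toℚᵘ-fromℚᵘ (ℚᵘ.mkℚᵘ (ℤ.+ suc n) 0) ⟩
  ℚᵘ.mkℚᵘ (ℤ.+ suc n) 0                   ≈⟨ ℚᵘ.*≡* (cong (λ m → (ℤ.+ 1 ℤ.+ m) ℤ.* ℤ.+ 1) (sym (ℤₚ.*-identityʳ (ℤ.+ n)))) ⟩
  ℚᵘ.1ℚᵘ ℚᵘ.+ ℚᵘ.mkℚᵘ (ℤ.+ n) 0           ≈⟨ ℚᵘₚ.+-congʳ ℚᵘ.1ℚᵘ (ℚᵘₚ.≃-sym (ℚₚ.toℚᵘ-fromℚᵘ (ℚᵘ.mkℚᵘ (ℤ.+ n) 0))) ⟩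
  ℚ.toℚᵘ 1ℚ ℚᵘ.+ ℚ.toℚᵘ (ℤ.+ n ℚ./ 1)     ≈⟨ ℚᵘₚ.≃-sym (ℚₚ.toℚᵘ-homo-+ 1ℚ (ℤ.+ n ℚ./ 1)) ⟩
  ℚ.toℚᵘ (1ℚ ℚ.+ ℤ.+ n ℚ./ 1) ∎)
  where
  open ℚᵘₚ.≃-Reasoning

0≤+n/1 : ∀ n → 0ℚ ℚ.≤ ℤ.+ n ℚ./ 1
0≤+n/1 n = ℚₚ.nonNegative⁻¹ _ {{ℚₚ.normalize-nonNeg n 1}}

archimedeanℚ : ∀ p {q} → 0ℚ ℚ.< q → ∃[ k ] p ℚ.≤ (ℤ.+ k ℚ./ 1) ℚ.* q
archimedeanℚ p {q} 0<q =
  let k , p/q≤k = bound (p ℚ.* 1/q)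
  in k , ℚₚ.≤-trans (ℚₚ.≤-reflexive p≡) (ℚₚ.*-monoʳ-≤-nonNeg q {{ℚ.nonNegative (ℚₚ.<⇒≤ 0<q)}} p/q≤k)
  where
  instance
    q≢0 : ℚ.NonZero q
    q≢0 = ℚₚ.pos⇒nonZero q {{ℚ.positive 0<q}}
  1/q = ℚ.1/ q
  p≡ : p ≡ p ℚ.* 1/q ℚ.* q
  p≡ = sym (trans (ℚₚ.*-assoc p 1/q q) (trans (cong (p ℚ.*_) (ℚₚ.*-inverseˡ q)) (ℚₚ.*-identityʳ p)))
  bound : ∀ r → ∃[ k ] r ℚ.≤ ℤ.+ k ℚ./ 1
  -- The denominator `suc d` is at least 1, so the absolute value of the numerator already bounds
  -- the fraction.
  bound r@(ℚ.mkℚ n d _) = ℤ.∣ n ∣ , ℚₚ.toℚᵘ-cancel-≤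
    (ℚᵘₚ.≤-trans (ℚᵘ.*≤* (ℤₚ.≤-trans (ℤₚ.≤-trans (ℤₚ.≤-reflexive (ℤₚ.*-identityʳ n)) n≤∣n∣)
       (ℤₚ.≤-trans (ℤ.+≤+ (ℕₚ.m≤m*n ℤ.∣ n ∣ (suc d))) (ℤₚ.≤-reflexive (ℤₚ.pos-* ℤ.∣ n ∣ (suc d))))))
      (ℚᵘₚ.≤-reflexive (ℚᵘₚ.≃-sym (ℚₚ.toℚᵘ-fromℚᵘ (ℚᵘ.mkℚᵘ (ℤ.+ ℤ.∣ n ∣) 0)))))
    where
    n≤∣n∣ : ∀ {n} → n ℤ.≤ ℤ.+ ℤ.∣ n ∣
    n≤∣n∣ {ℤ.+ _}      = ℤₚ.≤-refl
    n≤∣n∣ {ℤ.-[1+ _ ]} = ℤ.-≤+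

-- Order on the Cauchy reals

-- x and y cannot be inferred from the type x ≤ y, which unfolds.
infix 4 _⊑_
record _⊑_ (x y : ℝ) : Set where
  constructor ⌊_⌋
  field ⌈_⌉ : x ≤ y

open _⊑_

eventually-≤⇒⊑ : ∀ {x y} N → (∀ n → N ℕ.≤ n → seq x n ℚ.≤ seq y n) → x ⊑ y
eventually-≤⇒⊑ {x} {y} N h = ⌊ (λ η 0<η → N , λ n n≥ → ℚₚ.≤-trans (h n n≥)
  (ℚₚ.≤-trans (ℚₚ.≤-reflexive (sym (ℚₚ.+-identityʳ (seq y n))))
    (ℚₚ.+-monoʳ-≤ (seq y n) (ℚₚ.<⇒≤ 0<η)))) ⌋

⊑-reflexive : ∀ {x y} → (∀ n → seq x n ≡ seq y n) → x ⊑ y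
⊑-reflexive h = eventually-≤⇒⊑ 0 λ n _ → ℚₚ.≤-reflexive (h n)

⊑-refl : ∀ {x} → x ⊑ x
⊑-refl = ⊑-reflexive λ _ → refl

⊑-trans : ∀ {x y z} → x ⊑ y → y ⊑ z → x ⊑ z
⊑-trans {x} {y} {z} ⌊ p ⌋ ⌊ q ⌋ = ⌊ (λ η 0<η →
  let M , p′ = p (½ ℚ.* η) (0<½* 0<η)
      N , q′ = q (½ ℚ.* η) (0<½* 0<η)
  in M ℕ.⊔ N , λ n n≥ → ≤-rearrange
       (ℚₚ.+-mono-≤ (p′ n (ℕₚ.m⊔n≤o⇒m≤o M N n≥)) (q′ n (ℕₚ.m⊔n≤o⇒n≤o M N n≥)))
       (solve 4 (λ a b c e → c :+ e :- a := (b :+ con ½ :* e :+ (c :+ con ½ :* e)) :- (a :+ b)) refl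
         (seq x n) (seq y n) (seq z n) η)) ⌋

+-mono-⊑ : ∀ {x y u v} → x ⊑ y → u ⊑ v → x + u ⊑ y + v
+-mono-⊑ {x} {y} {u} {v} ⌊ p ⌋ ⌊ q ⌋ = ⌊ (λ η 0<η →
  let M , p′ = p (½ ℚ.* η) (0<½* 0<η)
      N , q′ = q (½ ℚ.* η) (0<½* 0<η)
  in M ℕ.⊔ N , λ n n≥ → ≤-rearrange
       (ℚₚ.+-mono-≤ (p′ n (ℕₚ.m⊔n≤o⇒m≤o M N n≥)) (q′ n (ℕₚ.m⊔n≤o⇒n≤o M N n≥)))
       (solve 5 (λ a b c d e → (b :+ d) :+ e :- (a :+ c)
           := (b :+ con ½ :* e :+ (d :+ con ½ :* e)) :- (a :+ c)) refl
         (seq x n) (seq y n) (seq u n) (seq v n) η)) ⌋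

-- An inequality depends only on the difference of its sides. Since the ring operations act
-- termwise, any linear combination of known inequalities reduces to a polynomial identity between
-- rational terms, which the ring solver settles.
⊑-rearrange : ∀ {x y a b} → x ⊑ y →
  (∀ n → seq b n ℚ.- seq a n ≡ seq y n ℚ.- seq x n) → a ⊑ b
⊑-rearrange {x} {y} {a} {b} ⌊ p ⌋ eq = ⌊ (λ η 0<η →
  let N , p′ = p η 0<η
  in N , λ n n≥ → ≤-rearrange (p′ n n≥)
    (trans (solve 3 (λ a b e → b :+ e :- a := b :- a :+ e) refl (seq a n) (seq b n) η)
      (trans (cong (ℚ._+ η) (eq n))
        (solve 3 (λ x y e → y :- x :+ e := y :+ e :- x) refl (seq x n) (seq y n) η)))) ⌋

⊑⇒0⊑- : ∀ x y → x ⊑ y → 0ℝ ⊑ y - x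
⊑⇒0⊑- x y p = ⊑-rearrange p λ n →
  solve 2 (λ x y → y :- x :- con 0ℚ := y :- x) refl (seq x n) (seq y n)

-- If a, b ≥ - θ then (a + θ) (b + θ) ≥ 0, that is a b ≥ - θ (a + b + θ).
near-nonneg-product : ∀ {a b θ A B η} → 0ℚ ℚ.≤ θ → θ ℚ.≤ 1ℚ → θ ℚ.* (A ℚ.+ B ℚ.+ 1ℚ) ℚ.≤ η →
  0ℚ ℚ.≤ a ℚ.+ θ → 0ℚ ℚ.≤ b ℚ.+ θ → a ℚ.≤ A → b ℚ.≤ B → 0ℚ ℚ.≤ a ℚ.* b ℚ.+ η
near-nonneg-product {a} {b} {θ} {A} {B} {η} 0≤θ θ≤1 θC≤η 0≤a+θ 0≤b+θ a≤A b≤B =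
  ≤-rearrange
    (ℚₚ.+-mono-≤ (ℚₚ.+-mono-≤ (0≤p*q 0≤a+θ 0≤b+θ)
      (0≤p*q 0≤θ (0≤q-p (ℚₚ.+-mono-≤ (ℚₚ.+-mono-≤ a≤A b≤B) θ≤1)))) θC≤η)
    (solve 6 (λ a b t A B e →
       a :* b :+ e :- con 0ℚ :=
       ((a :+ t) :* (b :+ t) :+ t :* (A :+ B :+ con 1ℚ :- (a :+ b :+ t)) :+ e) :-
       (con 0ℚ :+ con 0ℚ :+ t :* (A :+ B :+ con 1ℚ)))
      refl a b θ A B η)

-- Supplies the `θ` of `near-nonneg-product`: the minimum of 1 and `η / C`.
small-multiplier : ∀ {C η} → 0ℚ ℚ.< C → 0ℚ ℚ.< η →
  ∃[ θ ] (0ℚ ℚ.< θ) × (θ ℚ.≤ 1ℚ) × (θ ℚ.* C ℚ.≤ η)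
small-multiplier {C} {η} 0<C 0<η =
  1ℚ ℚ.⊓ (η ℚ.* 1/C) , ⊓-pos {1ℚ} {η ℚ.* 1/C} (ℚₚ.positive⁻¹ 1ℚ) (ℚₚ.positive⁻¹ _
    {{ℚₚ.pos*pos⇒pos η {{ℚ.positive 0<η}} 1/C {{ℚₚ.1/pos⇒pos C {{ℚ.positive 0<C}}}}}}) ,
  ℚₚ.p⊓q≤p 1ℚ (η ℚ.* 1/C) ,
  ℚₚ.≤-trans
    (ℚₚ.*-monoʳ-≤-nonNeg C {{ℚ.nonNegative (ℚₚ.<⇒≤ 0<C)}} (ℚₚ.p⊓q≤q 1ℚ (η ℚ.* 1/C)))
    (ℚₚ.≤-reflexive (trans (ℚₚ.*-assoc η 1/C C)
      (trans (cong (η ℚ.*_) (ℚₚ.*-inverseˡ C)) (ℚₚ.*-identityʳ η))))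
  where
  instance
    C≢0 : ℚ.NonZero C
    C≢0 = ℚₚ.pos⇒nonZero C {{ℚ.positive 0<C}}
  1/C = ℚ.1/ C
  ⊓-pos : ∀ {p q} → 0ℚ ℚ.< p → 0ℚ ℚ.< q → 0ℚ ℚ.< p ℚ.⊓ q
  ⊓-pos {p} {q} 0<p 0<q with ℚₚ.⊓-sel p q
  ... | inj₁ eq = subst (0ℚ ℚ.<_) (sym eq) 0<p
  ... | inj₂ eq = subst (0ℚ ℚ.<_) (sym eq) 0<q

-- A nonnegative real may have negative terms, but they are eventually at least `- θ` for each
-- positive `θ`. With eventual bounds `A` and `B` on the factors, `θ (A + B + 1) ≤ η` keeps the
-- product of the terms at least `- η`.
0⊑* : ∀ x y → 0ℝ ⊑ x → 0ℝ ⊑ y → 0ℝ ⊑ x * y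
0⊑* x y ⌊ p ⌋ ⌊ q ⌋ = ⌊ (λ η 0<η →
  let A , 0<A , K , ∣x∣≤A = bounded x
      B , 0<B , J , ∣y∣≤B = bounded y
      θ , 0<θ , θ≤1 , θC≤η = small-multiplier {A ℚ.+ B ℚ.+ 1ℚ} {η}
        (ℚₚ.+-mono-< (ℚₚ.+-mono-< 0<A 0<B) (ℚₚ.positive⁻¹ 1ℚ)) 0<η
      M , p′ = p θ 0<θ
      N , q′ = q θ 0<θ
      KJ = K ℕ.⊔ J
      MN = M ℕ.⊔ N
  in KJ ℕ.⊔ MN , λ n n≥ →
    let nKJ = ℕₚ.m⊔n≤o⇒m≤o KJ MN n≥
        nMN = ℕₚ.m⊔n≤o⇒n≤o KJ MN n≥
    in near-nonneg-product {seq x n} {seq y n} {θ} {A} {B} {η} (ℚₚ.<⇒≤ 0<θ) θ≤1 θC≤η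
         (p′ n (ℕₚ.m⊔n≤o⇒m≤o M N nMN)) (q′ n (ℕₚ.m⊔n≤o⇒n≤o M N nMN))
         (ℚₚ.≤-trans (p≤∣p∣ (seq x n)) (∣x∣≤A n (ℕₚ.m⊔n≤o⇒m≤o K J nKJ)))
         (ℚₚ.≤-trans (p≤∣p∣ (seq y n)) (∣y∣≤B n (ℕₚ.m⊔n≤o⇒n≤o K J nKJ)))) ⌋

*-monoʳ-⊑ : ∀ {x y z} → 0ℝ ⊑ z → x ⊑ y → z * x ⊑ z * y
*-monoʳ-⊑ {x} {y} {z} 0⊑z x⊑y = ⊑-rearrange (0⊑* z (y - x) 0⊑z (⊑⇒0⊑- x y x⊑y)) λ n →
  solve 3 (λ x y z → z :* y :- z :* x := z :* (y :- x) :- con 0ℚ) refl (seq x n) (seq y n) (seq z n)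

<⇒⊑ : ∀ {x y} → x < y → x ⊑ y
<⇒⊑ {x} (η , 0<η , N , h) = eventually-≤⇒⊑ N λ n n≥ → ℚₚ.≤-trans
  (ℚₚ.≤-trans (ℚₚ.≤-reflexive (sym (ℚₚ.+-identityʳ (seq x n))))
    (ℚₚ.+-monoʳ-≤ (seq x n) (ℚₚ.<⇒≤ 0<η))) (h n n≥)

⊑⇒≯ : ∀ {x y} → x ⊑ y → ¬ y < x
⊑⇒≯ {x} {y} ⌊ p ⌋ (η , 0<η , M , q) =
  let N , p′ = p (½ ℚ.* η) (0<½* 0<η)
      n  = M ℕ.⊔ N
      η≤ = ℚₚ.+-mono-≤ (q n (ℕₚ.m≤m⊔n M N)) (p′ n (ℕₚ.m≤n⊔m M N))
  in ℚₚ.<-irrefl refl (ℚₚ.<-≤-trans (0<½* 0<η) (≤-rearrange η≤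
       (solve 3 (λ a b e → con 0ℚ :- con ½ :* e
           := a :+ (b :+ con ½ :* e) :- (b :+ e :+ a)) refl (seq x n) (seq y n) η)))

-- Rational order is decidable, so a single comparison at an index `K` suffices, beyond which both
-- sequences vary by at most `θ = η / 8`. If `x` exceeds `y` by more than `η / 2` at `K`, it stays
-- at least `η / 4` above, contradicting the hypothesis; otherwise the later excess is at most
-- `η / 2 + 2 θ`, below `η`.
≯⇒⊑ : ∀ {x y} → ¬ y < x → x ⊑ y
≯⇒⊑ {x} {y} y≮x = ⌊ approximate ⌋
  where
  approximate : x ≤ y
  approximate η 0<η = decide (seq x K ℚₚ.≤? seq y K ℚ.+ ½ ℚ.* η)
    where
    θ = ½ ℚ.* (½ ℚ.* (½ ℚ.* η))
    0<θ = 0<½* (0<½* (0<½* 0<η))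
    M = proj₁ (cauchy x θ 0<θ)
    N = proj₁ (cauchy y θ 0<θ)
    K = M ℕ.⊔ N
    x-close : ∀ m n → K ℕ.≤ m → K ℕ.≤ n → seq x m ℚ.≤ seq x n ℚ.+ θ
    x-close m n m≥ n≥ = ∣p-q∣≤r⇒p≤q+r
      (proj₂ (cauchy x θ 0<θ) m n (ℕₚ.m⊔n≤o⇒m≤o M N m≥) (ℕₚ.m⊔n≤o⇒m≤o M N n≥))
    y-close : ∀ m n → K ℕ.≤ m → K ℕ.≤ n → seq y m ℚ.≤ seq y n ℚ.+ θ
    y-close m n m≥ n≥ = ∣p-q∣≤r⇒p≤q+r
      (proj₂ (cauchy y θ 0<θ) m n (ℕₚ.m⊔n≤o⇒n≤o M N m≥) (ℕₚ.m⊔n≤o⇒n≤o M N n≥))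
    decide : Dec (seq x K ℚ.≤ seq y K ℚ.+ ½ ℚ.* η) →
             ∃[ L ] ∀ n → L ℕ.≤ n → seq x n ℚ.≤ seq y n ℚ.+ η
    decide (yes x≤y) = K , λ n n≥ → ≤-rearrange
      (ℚₚ.+-mono-≤ (ℚₚ.+-mono-≤ (x-close n K n≥ ℕₚ.≤-refl) x≤y)
        (ℚₚ.+-mono-≤ (y-close K n ℕₚ.≤-refl n≥) (ℚₚ.<⇒≤ (0<½* (0<½* 0<η)))))
      (solve 5 (λ a b c d e →
         let h = con ½ :* e ; t = con ½ :* (con ½ :* h) in
         d :+ e :- c :=
         (a :+ t) :+ (b :+ h) :+ ((d :+ t) :+ con ½ :* h) :- (c :+ a :+ (b :+ con 0ℚ)))
        refl (seq x K) (seq y K) (seq x n) (seq y n) η)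
    decide (no x≰y) = contradiction
      (½ ℚ.* (½ ℚ.* η) , 0<½* (0<½* 0<η) , K , λ n n≥ → ≤-rearrange
        (ℚₚ.+-mono-≤ (ℚₚ.+-mono-≤ (x-close K n ℕₚ.≤-refl n≥) (ℚₚ.<⇒≤ (ℚₚ.≰⇒> x≰y)))
          (y-close n K n≥ ℕₚ.≤-refl))
        (solve 5 (λ a b c d e →
           let h = con ½ :* e ; t = con ½ :* (con ½ :* h) in
           c :- (d :+ con ½ :* h) :=
           (c :+ t) :+ a :+ (b :+ t) :- (a :+ (b :+ h) :+ d))
          refl (seq x K) (seq y K) (seq x n) (seq y n) η))
      y≮x

-- Inequalities are ¬¬-stable, so a proof of one may decide another.
⊑-cases : ∀ {x y a b} → (x ⊑ y → a ⊑ b) → (y < x → a ⊑ b) → a ⊑ b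
⊑-cases ifLess ifGreater = ≯⇒⊑ λ b<a →
  ⊑⇒≯ (ifLess (≯⇒⊑ λ y<x → ⊑⇒≯ (ifGreater y<x) b<a)) b<a

*-cancelˡ-⊑ : ∀ {x y z} → 0ℝ < z → z * x ⊑ z * y → x ⊑ y
*-cancelˡ-⊑ {x} {y} {z} 0<z zx⊑zy = ≯⇒⊑ λ y<x →
  ⊑⇒≯ 0⊑z[y-x] (*-pos {z} {x - y} 0<z (0<- y<x))
  where
  0<- : y < x → 0ℝ < x - y
  0<- (η , 0<η , N , h) = η , 0<η , N , λ n n≥ → ≤-rearrange (h n n≥)
    (solve 3 (λ x y e → x :- y :- (con 0ℚ :+ e) := x :- (y :+ e)) refl (seq x n) (seq y n) η)
  0⊑z[y-x] : z * (x - y) ⊑ 0ℝ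
  0⊑z[y-x] = ⊑-rearrange zx⊑zy λ n →
    solve 3 (λ x y z → con 0ℚ :- z :* (x :- y) := z :* y :- z :* x) refl (seq x n) (seq y n) (seq z n)

-- Depending on the sign of the slope β, one of the two endpoints suffices.
affine-bound : ∀ h α β r r₁ r₂ → r₁ ⊑ r → r ⊑ r₂ →
  h ⊑ α + r₁ * β → h ⊑ α + r₂ * β → h ⊑ α + r * β
affine-bound h α β r r₁ r₂ r₁⊑r r⊑r₂ at-r₁ at-r₂ =
  ⊑-cases {0ℝ} {β}
    (λ 0⊑β → ⊑-rearrange (+-mono-⊑ at-r₁ (0⊑* (r - r₁) β (⊑⇒0⊑- r₁ r r₁⊑r) 0⊑β)) λ n →
      solve 5 (λ h α β r r₁ → α :+ r :* β :- h
          := α :+ r₁ :* β :+ (r :- r₁) :* β :- (h :+ con 0ℚ)) refl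
        (seq h n) (seq α n) (seq β n) (seq r n) (seq r₁ n))
    (λ β<0 → ⊑-rearrange (+-mono-⊑ at-r₂ (0⊑* (r₂ - r) (0ℝ - β) (⊑⇒0⊑- r r₂ r⊑r₂)
        (⊑⇒0⊑- β 0ℝ (<⇒⊑ {β} {0ℝ} β<0)))) λ n →
      solve 5 (λ h α β r r₂ → α :+ r :* β :- h
          := α :+ r₂ :* β :+ (r₂ :- r) :* (con 0ℚ :- β) :- (h :+ con 0ℚ)) refl
        (seq h n) (seq α n) (seq β n) (seq r n) (seq r₂ n))

0⊑fromℕ : ∀ n → 0ℝ ⊑ fromℕ n
0⊑fromℕ n = eventually-≤⇒⊑ 0 λ _ _ → 0≤+n/1 n

1⊑fromℕ : ∀ n .{{_ : NonZero n}} → 1ℝ ⊑ fromℕ n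
1⊑fromℕ (suc n) = ⊑-rearrange (0⊑fromℕ n) λ _ →
  trans (cong (ℚ._- 1ℚ) (+n/1-suc n))
    (solve 1 (λ x → con 1ℚ :+ x :- con 1ℚ := x :- con 0ℚ) refl (ℤ.+ n ℚ./ 1))

archimedean : ∀ {x ε} → 0ℝ < ε → ∃[ k ] x ⊑ fromℕ k * ε
archimedean {x} {ε} (e , 0<e , M , e≤ε) =
  let B , _ , N , ∣x∣≤B = bounded x
      k , B≤ke = archimedeanℚ B 0<e
  in k , eventually-≤⇒⊑ (M ℕ.⊔ N) λ n n≥ →
    ℚₚ.≤-trans (p≤∣p∣ (seq x n)) (ℚₚ.≤-trans (∣x∣≤B n (ℕₚ.m⊔n≤o⇒n≤o M N n≥)) (ℚₚ.≤-trans B≤ke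
      (ℚₚ.*-monoˡ-≤-nonNeg (ℤ.+ k ℚ./ 1) {{ℚ.nonNegative (0≤+n/1 k)}}
        (ℚₚ.≤-trans (ℚₚ.≤-reflexive (sym (ℚₚ.+-identityˡ e)))
          (e≤ε n (ℕₚ.m⊔n≤o⇒m≤o M N n≥))))))

-- From `N` on the terms of `x` are at least `η`, so the clipping inside `recip` is inactive and the
-- cancellation is exact termwise.
*-recip : ∀ x y e (0<x : 0ℝ < x) → (∀ n → seq e n ≡ seq y n ℚ.* seq (recip x 0<x) n) →
  (x * e ⊑ y) × (y ⊑ x * e)
*-recip x y e (η , 0<η , N , η≤x) e≡ =
  eventually-≤⇒⊑ N (λ n n≥ → ℚₚ.≤-reflexive (eventually n n≥)) ,
  eventually-≤⇒⊑ N (λ n n≥ → ℚₚ.≤-reflexive (sym (eventually n n≥)))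
  where
  1/x = recip x (η , 0<η , N , η≤x)
  cancel : ∀ {a r} b → a ℚ.* r ≡ 1ℚ → a ℚ.* (b ℚ.* r) ≡ b
  cancel {a} {r} b ar≡1 = trans
    (solve 3 (λ a b r → a :* (b :* r) := b :* (a :* r)) refl a b r)
    (trans (cong (b ℚ.*_) ar≡1) (ℚₚ.*-identityʳ b))
  eventually : ∀ n → N ℕ.≤ n → seq x n ℚ.* seq e n ≡ seq y n
  eventually n n≥ = trans (cong (seq x n ℚ.*_) (e≡ n)) (cancel {seq x n} {seq 1/x n} (seq y n)
    (trans (cong (ℚ._* seq 1/x n) (sym c≡x))
      (ℚₚ.*-inverseʳ c {{ℚₚ.pos⇒nonZero c {{ℚ.positive 0<c}}}})))
    where
    c = seq x n ℚ.⊔ η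
    c≡x : c ≡ seq x n
    c≡x = ℚₚ.p≥q⇒p⊔q≡p (ℚₚ.≤-trans (ℚₚ.≤-reflexive (sym (ℚₚ.+-identityˡ η))) (η≤x n n≥))
    0<c : 0ℚ ℚ.< c
    0<c = ℚₚ.<-≤-trans 0<η (ℚₚ.p≤q⊔p (seq x n) η)

-- Superhedging prices

x⊑∣x∣ : ∀ x → x ⊑ ∣ x ∣
x⊑∣x∣ x = eventually-≤⇒⊑ 0 λ n _ → p≤∣p∣ (seq x n)

∣x∣⊑ : ∀ {x d} → x ⊑ d → - x ⊑ d → ∣ x ∣ ⊑ d
∣x∣⊑ {x} {d} ⌊ p ⌋ ⌊ q ⌋ = ⌊ (λ η 0<η →
  let M , p′ = p η 0<η
      N , q′ = q η 0<η
  in M ℕ.⊔ N , λ n n≥ →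
       either (p′ n (ℕₚ.m⊔n≤o⇒m≤o M N n≥)) (q′ n (ℕₚ.m⊔n≤o⇒n≤o M N n≥))) ⌋
  where
  either : ∀ {a b} → a ℚ.≤ b → ℚ.- a ℚ.≤ b → ℚ.∣ a ∣ ℚ.≤ b
  either {a} a≤b -a≤b with ℚₚ.∣p∣≡p∨∣p∣≡-p a
  ... | inj₁ eq = ℚₚ.≤-trans (ℚₚ.≤-reflexive eq) a≤b
  ... | inj₂ eq = ℚₚ.≤-trans (ℚₚ.≤-reflexive eq) -a≤b

-- One-sided and free of absolute values: `d` is any bound for the distance of `x` and `y`. In this
-- form the property combines linearly with other inequalities.
Lipschitz : ℝ → (ℝ → ℝ) → Set
Lipschitz L f = ∀ x y d → x - y ⊑ d → y - x ⊑ d → f x ⊑ f y + L * d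

lipschitzWith⇒lipschitz : ∀ {L f} → 0ℝ ⊑ L → LipschitzWith L f → Lipschitz L f
lipschitzWith⇒lipschitz {L} {f} 0⊑L lip x y d x-y⊑d y-x⊑d =
  from-difference (f x) (f y) (L * d) (⊑-trans (x⊑∣x∣ (f x - f y))
    (⊑-trans f-f⊑ (*-monoʳ-⊑ {∣ x - y ∣} {d} {L} 0⊑L ∣x-y∣⊑d)))
  where
  from-difference : ∀ a b c → a - b ⊑ c → a ⊑ b + c
  from-difference a b c a-b⊑c = ⊑-rearrange a-b⊑c λ n →
    solve 3 (λ a b c → b :+ c :- a := c :- (a :- b)) refl (seq a n) (seq b n) (seq c n)
  f-f⊑ : ∣ f x - f y ∣ ⊑ L * ∣ x - y ∣
  f-f⊑ = ⌊ lip y x ⌋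
  ∣x-y∣⊑d : ∣ x - y ∣ ⊑ d
  ∣x-y∣⊑d = ∣x∣⊑ x-y⊑d (⊑-rearrange y-x⊑d λ n →
    solve 3 (λ x y d → d :- (:- (x :- y)) := d :- (y :- x)) refl (seq x n) (seq y n) (seq d n))

backward-induction : ∀ {τ} (P : ℕ → Set) →
  P τ → (∀ t → t ℕ.< τ → P (suc t) → P t) → P 0
backward-induction {zero}  P last step = last
backward-induction {suc τ} P last step =
  backward-induction P (step τ ℕₚ.≤-refl last) λ t t<τ → step t (ℕₚ.m<n⇒m<1+n t<τ)

-- Epigraph form of a min-max. The minimiser `Δ*` is feasible at level `v`; conversely, feasibility
-- of `p` and `Δ`, tested at the return attaining the maximum, gives `M Δ ≤ p`.
minMax⇒optimal : ∀ {U f v} →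
  IsMinMax U (λ Δ R → f R - R * Δ) v → IsOptimalValue U f v
minMax⇒optimal {U} {f} {v} (M , isMax , (Δ* , MΔ*≈v) , v≤M) =
  (Δ* , λ r Ur → ⌈ ⊑-trans {f r - r * Δ*} {M Δ*} {v} ⌊ proj₂ (isMax Δ*) r Ur ⌋ ⌊ proj₁ MΔ*≈v ⌋ ⌉) ,
  λ p Δ feasible →
    let (R , UR , fR≈M) , _ = isMax Δ
    in ⌈ ⊑-trans {v} {M Δ} {p} ⌊ v≤M Δ ⌋
           (⊑-trans {M Δ} {f R - R * Δ} {p} ⌊ proj₂ fR≈M ⌋ ⌊ feasible R UR ⌋) ⌉

valueFunction⇒tree : ∀ {τ U g G} → IsValueFunction τ U g G → IsTreeApproximation τ U g G
valueFunction⇒tree {U = U} {G = G} (last , minMax) = last , λ t t<τ x →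
  minMax⇒optimal {U} {λ R → G (suc t) (x * (1ℝ + R))} {G t x} (minMax t t<τ x)

module Superhedging (τ : ℕ) (U : ℝ → Set) (g : ℝ → ℝ) (G : ℕ → ℝ → ℝ)
  (prices : IsTreeApproximation τ U g G) where

  last-⊑ : ∀ x → G τ x ⊑ g x
  last-⊑ x = ⌊ proj₁ (proj₁ prices x) ⌋

  last-⊒ : ∀ x → g x ⊑ G τ x
  last-⊒ x = ⌊ proj₂ (proj₁ prices x) ⌋

  -- `hedge` and `price-least` recast the linear program as superhedging: capital `v` together with
  -- the gain `r * Δ` must cover the next value. All later arguments use only these two facts.
  hedge : ∀ {t} → t ℕ.< τ → ∀ x →
    ∃[ Δ ] (∀ r → U r → G (suc t) (x * (1ℝ + r)) ⊑ G t x + r * Δ)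
  hedge {t} t<τ x =
    let (Δ , feasible) , _ = proj₂ prices t t<τ x
    in Δ , λ r Ur → from-profit (G (suc t) (x * (1ℝ + r))) (G t x) r Δ ⌊ feasible r Ur ⌋
    where
    from-profit : ∀ h v r Δ → h - r * Δ ⊑ v → h ⊑ v + r * Δ
    from-profit h v r Δ p = ⊑-rearrange p λ n →
      solve 4 (λ h v r D → v :+ r :* D :- h := v :- (h :- r :* D)) refl
        (seq h n) (seq v n) (seq r n) (seq Δ n)

  price-least : ∀ {t} → t ℕ.< τ → ∀ {x v} Δ →
    (∀ r → U r → G (suc t) (x * (1ℝ + r)) ⊑ v + r * Δ) → G t x ⊑ v
  price-least {t} t<τ {x} {v} Δ superhedges =
    ⌊ proj₂ (proj₂ prices t t<τ x) v Δ (λ r Ur →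
        ⌈ to-profit (G (suc t) (x * (1ℝ + r))) v r Δ (superhedges r Ur) ⌉) ⌋
    where
    to-profit : ∀ h v r Δ → h ⊑ v + r * Δ → h - r * Δ ⊑ v
    to-profit h v r Δ p = ⊑-rearrange p λ n →
      solve 4 (λ h v r D → v :- (h :- r :* D) := v :+ r :* D :- h) refl
        (seq h n) (seq v n) (seq r n) (seq Δ n)

  -- Buy and hold: capital `L * x` invested entirely in the stock becomes `L * (x * (1ℝ + r))`, so a
  -- linear bound passes unchanged from one round to the previous one.
  linear-bound : ∀ {L} → (∀ r → U r → 0ℝ ⊑ 1ℝ + r) → (∀ {x} → 0ℝ ⊑ x → g x ⊑ L * x) →
    ∀ {x} → 0ℝ ⊑ x → G 0 x ⊑ L * x
  linear-bound {L} U≥-1 g⊑L = backward-induction (λ t → ∀ {x} → 0ℝ ⊑ x → G t x ⊑ L * x)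
    (λ {x} 0⊑x → ⊑-trans (last-⊑ x) (g⊑L 0⊑x))
    λ t t<τ G⊑L {x} 0⊑x → price-least t<τ (L * x) λ r Ur →
      ⊑-trans (G⊑L (0⊑* x (1ℝ + r) 0⊑x (U≥-1 r Ur))) (⊑-reflexive λ n →
        solve 3 (λ l x r → l :* (x :* (con 1ℚ :+ r)) := l :* x :+ r :* (l :* x)) refl
          (seq L n) (seq x n) (seq r n))

  -- The hedged capital is affine in the return and nonnegative at `r₁` and `r₂`, hence also at the
  -- return 0 between them, where it equals the price.
  price-nonneg : ∀ {r₁ r₂} → (∀ r → U r → 0ℝ ⊑ 1ℝ + r) →
    U r₁ → U r₂ → r₁ ⊑ 0ℝ → 0ℝ ⊑ r₂ → (∀ {x} → 0ℝ ⊑ x → 0ℝ ⊑ g x) →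
    ∀ {x} → 0ℝ ⊑ x → 0ℝ ⊑ G 0 x
  price-nonneg {r₁} {r₂} U≥-1 Ur₁ Ur₂ r₁⊑0 0⊑r₂ 0⊑g =
    backward-induction (λ t → ∀ {x} → 0ℝ ⊑ x → 0ℝ ⊑ G t x)
    (λ {x} 0⊑x → ⊑-trans (0⊑g 0⊑x) (last-⊒ x))
    λ t t<τ 0⊑G {x} 0⊑x →
      let Δ , superhedges = hedge t<τ x
          0⊑hedge = λ r Ur → ⊑-trans (0⊑G (0⊑* x (1ℝ + r) 0⊑x (U≥-1 r Ur))) (superhedges r Ur)
      in ⊑-trans (affine-bound 0ℝ (G t x) Δ 0ℝ r₁ r₂ r₁⊑0 0⊑r₂ (0⊑hedge r₁ Ur₁) (0⊑hedge r₂ Ur₂)) (⊑-reflexive λ n →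
           solve 2 (λ p D → p :+ con 0ℚ :* D := p) refl (seq (G t x) n) (seq Δ n))

  lipschitz-last : ∀ {L} → Lipschitz L g → Lipschitz L (G τ)
  lipschitz-last {L} lip x y d x-y⊑d y-x⊑d =
    ⊑-trans (last-⊑ x)
      (⊑-trans (lip x y d x-y⊑d y-x⊑d) (+-mono-⊑ {g y} {G τ y} {L * d} {L * d} (last-⊒ y) ⊑-refl))

  -- Moving from y to x costs at most L d (1 + r), which L d extra units of stock
  -- and of initial capital pay for.
  lipschitz-step : ∀ {L t} → (∀ r → U r → 0ℝ ⊑ 1ℝ + r) →
    t ℕ.< τ → Lipschitz L (G (suc t)) → Lipschitz L (G t)
  lipschitz-step {L} {t} U≥-1 t<τ lip x y d x-y⊑d y-x⊑d =
    let Δ , superhedges = hedge t<τ y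
    in price-least t<τ (Δ + L * d) λ r Ur →
      ⊑-rearrange
        (+-mono-⊑ (lip (x * (1ℝ + r)) (y * (1ℝ + r)) (d * (1ℝ + r))
          (scale x y r (U≥-1 r Ur) x-y⊑d) (scale y x r (U≥-1 r Ur) y-x⊑d)) (superhedges r Ur)) λ n →
        solve 7 (λ a b p l d r D →
          p :+ l :* d :+ r :* (D :+ l :* d) :- a :=
          b :+ l :* (d :* (con 1ℚ :+ r)) :+ (p :+ r :* D) :- (a :+ b)) refl
          (seq (G (suc t) (x * (1ℝ + r))) n) (seq (G (suc t) (y * (1ℝ + r))) n)
          (seq (G t y) n) (seq L n) (seq d n) (seq r n) (seq Δ n)
    where
    scale : ∀ x y r → 0ℝ ⊑ 1ℝ + r → x - y ⊑ d → x * (1ℝ + r) - y * (1ℝ + r) ⊑ d * (1ℝ + r)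
    scale x y r 0⊑1+r x-y⊑d = ⊑-rearrange (*-monoʳ-⊑ 0⊑1+r x-y⊑d) λ n →
      solve 4 (λ x y d s → d :* s :- (x :* s :- y :* s) := s :* d :- s :* (x :- y)) refl
        (seq x n) (seq y n) (seq d n) (seq (1ℝ + r) n)

-- Continuation-passing form: since order on ℝ is undecidable, neighbouring grid
-- points can only be chosen while proving a stable statement.
Brackets : (U Û : ℝ → Set) → ℝ → Set
Brackets U Û ε = ∀ {R a b} → U R →
  (∀ r₁ r₂ → Û r₁ → Û r₂ → r₁ ⊑ R → R ⊑ r₂ → r₂ - r₁ ⊑ ε → a ⊑ b) → a ⊑ b

within-bracket : ∀ {ε} r₁ R r₂ → r₁ ⊑ R → R ⊑ r₂ → r₂ - r₁ ⊑ ε →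
  (R - r₁ ⊑ ε) × (r₁ - R ⊑ ε) × (R - r₂ ⊑ ε) × (r₂ - R ⊑ ε)
within-bracket {ε} r₁ R r₂ r₁⊑R R⊑r₂ r₂-r₁⊑ε =
  ⊑-rearrange (+-mono-⊑ R⊑r₂ r₂-r₁⊑ε) (λ n →
    solve 4 (λ a R b e → e :- (R :- a) := b :+ e :- (R :+ (b :- a))) refl
      (seq r₁ n) (seq R n) (seq r₂ n) (seq ε n)) ,
  -- Here `ε` must dominate a nonpositive difference. That `ε` is nonnegative comes from
  -- `r₁ ⊑ R ⊑ r₂` and the gap bound, so one endpoint inequality is used a second time.
  ⊑-rearrange (+-mono-⊑ (+-mono-⊑ r₁⊑R r₁⊑R) (+-mono-⊑ R⊑r₂ r₂-r₁⊑ε)) (λ n →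
    solve 4 (λ a R b e → e :- (a :- R) := R :+ R :+ (b :+ e) :- (a :+ a :+ (R :+ (b :- a)))) refl
      (seq r₁ n) (seq R n) (seq r₂ n) (seq ε n)) ,
  ⊑-rearrange (+-mono-⊑ (+-mono-⊑ R⊑r₂ R⊑r₂) (+-mono-⊑ r₁⊑R r₂-r₁⊑ε)) (λ n →
    solve 4 (λ a R b e → e :- (R :- b) := b :+ b :+ (R :+ e) :- (R :+ R :+ (a :+ (b :- a)))) refl
      (seq r₁ n) (seq R n) (seq r₂ n) (seq ε n)) ,
  ⊑-rearrange (+-mono-⊑ r₁⊑R r₂-r₁⊑ε) (λ n →
    solve 4 (λ a R b e → e :- (b :- R) := R :+ e :- (a :+ (b :- a))) refl
      (seq r₁ n) (seq R n) (seq r₂ n) (seq ε n))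

-- Comparison of the prices over two nested return sets

module Comparison (τ : ℕ) (U Û : ℝ → Set) (g : ℝ → ℝ) (G Ĝ : ℕ → ℝ → ℝ)
  (Û⊆U : ∀ r → Û r → U r)
  (prices : IsTreeApproximation τ U g G) (pricesˆ : IsTreeApproximation τ Û g Ĝ) where

  private
    module U = Superhedging τ U g G prices
    module Û = Superhedging τ Û g Ĝ pricesˆ

  restriction-⊑ : ∀ x → Ĝ 0 x ⊑ G 0 x
  restriction-⊑ = backward-induction (λ t → ∀ x → Ĝ t x ⊑ G t x)
    (λ x → ⊑-trans (Û.last-⊑ x) (U.last-⊒ x))
    λ t t<τ Ĝ⊑G x →
      let Δ , superhedges = U.hedge t<τ x
      in Û.price-least t<τ Δ λ r Ûr → ⊑-trans (Ĝ⊑G _) (superhedges r (Û⊆U r Ûr))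

  scale-return : ∀ ε x r s → 0ℝ ⊑ x → r - s ⊑ ε → x * (1ℝ + r) - x * (1ℝ + s) ⊑ x * ε
  scale-return ε x r s 0⊑x r-s⊑ε = ⊑-rearrange (*-monoʳ-⊑ 0⊑x r-s⊑ε) λ n →
    solve 4 (λ x r s e → x :* e :- (x :* (con 1ℚ :+ r) :- x :* (con 1ℚ :+ s))
        := x :* e :- x :* (r :- s)) refl
      (seq x n) (seq r n) (seq s n) (seq ε n)

  -- The carried error `k′ * (x * (1ℝ + r))` splits as `k′ * x + r * (k′ * x)`: the first part is
  -- paid from capital, the second by enlarging the hedge by `k′ * x`. Together with the rounding
  -- cost `e`, the capital part must fit into `k * x`.
  combine : ∀ h h′ ĥ p k k′ x r Δ e → h ⊑ h′ + e → h′ ⊑ ĥ + k′ * (x * (1ℝ + r)) →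
    ĥ ⊑ p + r * Δ → k′ * x + e ⊑ k * x → h ⊑ p + k * x + r * (Δ + k′ * x)
  combine h h′ ĥ p k k′ x r Δ e h⊑ h′⊑ ĥ⊑ k′⊑ =
    ⊑-rearrange (+-mono-⊑ (+-mono-⊑ h⊑ h′⊑) (+-mono-⊑ ĥ⊑ k′⊑)) λ n →
      solve 10 (λ a b c p k k′ x r D e →
        p :+ k :* x :+ r :* (D :+ k′ :* x) :- a :=
        b :+ e :+ (c :+ k′ :* (x :* (con 1ℚ :+ r))) :+ (p :+ r :* D :+ k :* x)
          :- (a :+ b :+ (c :+ (k′ :* x :+ e)))) refl
        (seq h n) (seq h′ n) (seq ĥ n) (seq p n) (seq k n) (seq k′ n)
        (seq x n) (seq r n) (seq Δ n) (seq e n)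

  module Step (L ε : ℝ) (U≥-1 : ∀ r → U r → 0ℝ ⊑ 1ℝ + r) (brackets : Brackets U Û ε)
    (t : ℕ) (t<τ : t ℕ.< τ) (k k′ : ℝ)
    (lip : Lipschitz L (G (suc t))) (G⊑Ĝ : ∀ x → 0ℝ ⊑ x → G (suc t) x ⊑ Ĝ (suc t) x + k′ * x)
    (x : ℝ) (0⊑x : 0ℝ ⊑ x) (k′⊑k : k′ * x + L * (x * ε) ⊑ k * x) where

    -- The left side is evaluated at `R` but the hedge at the grid point `r`. Both neighbours of `R`
    -- thus bound the same number, which lets `affine-bound` interpolate between them without any
    -- convexity of `G`.
    at-grid-point : ∀ r R Δ → Û r → R - r ⊑ ε → r - R ⊑ ε →
      Ĝ (suc t) (x * (1ℝ + r)) ⊑ Ĝ t x + r * Δ →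
      G (suc t) (x * (1ℝ + R)) ⊑ Ĝ t x + k * x + r * (Δ + k′ * x)
    at-grid-point r R Δ Ûr R-r⊑ε r-R⊑ε superhedges = combine
      (G (suc t) (x * (1ℝ + R))) (G (suc t) (x * (1ℝ + r))) (Ĝ (suc t) (x * (1ℝ + r)))
      (Ĝ t x) k k′ x r Δ (L * (x * ε))
      (lip (x * (1ℝ + R)) (x * (1ℝ + r)) (x * ε)
        (scale-return ε x R r 0⊑x R-r⊑ε) (scale-return ε x r R 0⊑x r-R⊑ε))
      (G⊑Ĝ (x * (1ℝ + r)) (0⊑* x (1ℝ + r) 0⊑x (U≥-1 r (Û⊆U r Ûr))))
      superhedges k′⊑k

    in-between : ∀ Δ → (∀ r → Û r → Ĝ (suc t) (x * (1ℝ + r)) ⊑ Ĝ t x + r * Δ) →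
      ∀ R → U R → G (suc t) (x * (1ℝ + R)) ⊑ Ĝ t x + k * x + R * (Δ + k′ * x)
    in-between Δ superhedges R UR =
      brackets {R} {G (suc t) (x * (1ℝ + R))} {Ĝ t x + k * x + R * (Δ + k′ * x)} UR
        λ r₁ r₂ Ûr₁ Ûr₂ r₁⊑R R⊑r₂ r₂-r₁⊑ε →
          let c₁ , c₂ , c₃ , c₄ = within-bracket {ε} r₁ R r₂ r₁⊑R R⊑r₂ r₂-r₁⊑ε
          in affine-bound (G (suc t) (x * (1ℝ + R))) (Ĝ t x + k * x) (Δ + k′ * x) R r₁ r₂ r₁⊑R R⊑r₂
               (at-grid-point r₁ R Δ Ûr₁ c₁ c₂ (superhedges r₁ Ûr₁))
               (at-grid-point r₂ R Δ Ûr₂ c₃ c₄ (superhedges r₂ Ûr₂))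

    error-step : G t x ⊑ Ĝ t x + k * x
    error-step =
      let Δ , superhedges = Û.hedge t<τ x
      in U.price-least t<τ (Δ + k′ * x) (in-between Δ superhedges)

  discretisation-error : ∀ {L ε} →
    (∀ r → U r → 0ℝ ⊑ 1ℝ + r) → Brackets U Û ε → Lipschitz L g →
    ∀ {x} → 0ℝ ⊑ x → G 0 x ⊑ Ĝ 0 x + fromℕ τ * (L * ε) * x
  discretisation-error {L} {ε} U≥-1 brackets lip {x} 0⊑x =
    ⊑-trans (proj₂ (backward-induction P last step) x 0⊑x) (⊑-reflexive λ n →
      solve 5 (λ p t l e x → p :+ (t :- con 0ℚ) :* (l :* e) :* x := p :+ t :* (l :* e) :* x) refl
        (seq (Ĝ 0 x) n) (seq (fromℕ τ) n) (seq L n) (seq ε n) (seq x n))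
    where
    -- Error per unit of stock price: `L * ε` for each of the `τ - t` rounds still to be played.
    K : ℕ → ℝ
    K t = (fromℕ τ - fromℕ t) * (L * ε)

    -- The Lipschitz property travels with the error bound because the error step at `t` rounds
    -- returns inside `G (suc t)`.
    P : ℕ → Set
    P t = Lipschitz L (G t) × (∀ x → 0ℝ ⊑ x → G t x ⊑ Ĝ t x + K t * x)

    last : P τ
    last = U.lipschitz-last {L} lip , λ x _ →
      ⊑-trans (⊑-trans (U.last-⊑ x) (Û.last-⊒ x)) (⊑-reflexive λ n →
        solve 5 (λ p t l e x → p := p :+ (t :- t) :* (l :* e) :* x) refl
          (seq (Ĝ τ x) n) (seq (fromℕ τ) n) (seq L n) (seq ε n) (seq x n))

    K-suc : ∀ t x → K (suc t) * x + L * (x * ε) ⊑ K t * x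
    K-suc t x = ⊑-reflexive λ n → trans
      (cong (λ s → (seq (fromℕ τ) n ℚ.- s) ℚ.* (seq L n ℚ.* seq ε n) ℚ.* seq x n
                     ℚ.+ seq L n ℚ.* (seq x n ℚ.* seq ε n)) (+n/1-suc t))
      (solve 5 (λ T t l e x → (T :- (con 1ℚ :+ t)) :* (l :* e) :* x :+ l :* (x :* e)
          := (T :- t) :* (l :* e) :* x) refl
        (seq (fromℕ τ) n) (ℤ.+ t ℚ./ 1) (seq L n) (seq ε n) (seq x n))

    step : ∀ t → t ℕ.< τ → P (suc t) → P t
    step t t<τ (lip′ , G⊑Ĝ) = U.lipschitz-step {L} {t} U≥-1 t<τ lip′ , λ x 0⊑x →
      Step.error-step L ε U≥-1 brackets t t<τ (K t) (K (suc t)) lip′ G⊑Ĝ x 0⊑x (K-suc t x)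

-- The grid

module Grid (ζ₋ ζ₊ ε : ℝ) (0<ζ₋ : 0ℝ < ζ₋) (0<ζ₊ : 0ℝ < ζ₊) (ζ₋≤1 : ζ₋ ≤ 1ℝ) (0<ε : 0ℝ < ε) where

  point : ℕ → ℝ
  point k = - ζ₋ + fromℕ k * ε

  0⊑ζ₋ : 0ℝ ⊑ ζ₋
  0⊑ζ₋ = <⇒⊑ {0ℝ} {ζ₋} 0<ζ₋

  0⊑ζ₊ : 0ℝ ⊑ ζ₊
  0⊑ζ₊ = <⇒⊑ {0ℝ} {ζ₊} 0<ζ₊

  0⊑ε : 0ℝ ⊑ ε
  0⊑ε = <⇒⊑ {0ℝ} {ε} 0<ε

  -ζ₋⊑0 : - ζ₋ ⊑ 0ℝ
  -ζ₋⊑0 = ⊑-rearrange 0⊑ζ₋ λ n →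
    solve 1 (λ z → con 0ℚ :- (:- z) := z :- con 0ℚ) refl (seq ζ₋ n)

  -ζ₋⊑ζ₊ : - ζ₋ ⊑ ζ₊
  -ζ₋⊑ζ₊ = ⊑-trans -ζ₋⊑0 0⊑ζ₊

  -ζ₋⊑point : ∀ k → - ζ₋ ⊑ point k
  -ζ₋⊑point k = ⊑-rearrange (0⊑* (fromℕ k) ε (0⊑fromℕ k) 0⊑ε) λ n →
    solve 3 (λ z k e → :- z :+ k :* e :- (:- z) := k :* e :- con 0ℚ) refl
      (seq ζ₋ n) (seq (fromℕ k) n) (seq ε n)

  point-suc : ∀ k → point (suc k) - point k ⊑ ε
  point-suc k = ⊑-reflexive λ n → trans
    (cong (λ s → ℚ.- seq ζ₋ n ℚ.+ s ℚ.* seq ε n ℚ.- (ℚ.- seq ζ₋ n ℚ.+ seq (fromℕ k) n ℚ.* seq ε n))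
      (+n/1-suc k))
    (solve 3 (λ z k e → :- z :+ (con 1ℚ :+ k) :* e :- (:- z :+ k :* e) := e) refl
      (seq ζ₋ n) (seq (fromℕ k) n) (seq ε n))

  -- Here `ζ₋ ≤ 1ℝ` enters: stock prices stay nonnegative, so inequalities may be scaled by
  -- `1ℝ + r`.
  interval≥-1 : ∀ r → interval ζ₋ ζ₊ r → 0ℝ ⊑ 1ℝ + r
  interval≥-1 r (-ζ₋≤r , _) =
    ⊑-rearrange (+-mono-⊑ {ζ₋} {1ℝ} { - ζ₋} {r} ⌊ ζ₋≤1 ⌋ ⌊ -ζ₋≤r ⌋) λ n →
      solve 2 (λ z r → con 1ℚ :+ r :- con 0ℚ := con 1ℚ :+ r :- (z :+ :- z)) refl
        (seq ζ₋ n) (seq r n)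

  grid⊆interval : ∀ r → grid ζ₋ ζ₊ ε r → interval ζ₋ ζ₊ r
  grid⊆interval r (inj₁ (k , r≈ , r≤ζ₊)) =
    ⌈ ⊑-trans { - ζ₋} {point k} {r} (-ζ₋⊑point k) ⌊ proj₂ r≈ ⌋ ⌉ , r≤ζ₊
  grid⊆interval r (inj₂ r≈ζ₊) =
    ⌈ ⊑-trans { - ζ₋} {ζ₊} {r} -ζ₋⊑ζ₊ ⌊ proj₂ r≈ζ₊ ⌋ ⌉ , proj₁ r≈ζ₊

  point-in-grid : ∀ k → point k ⊑ ζ₊ → grid ζ₋ ζ₊ ε (point k)
  point-in-grid k ⌊ point≤ζ₊ ⌋ = inj₁ (k , (⌈ ⊑-refl {point k} ⌉ , ⌈ ⊑-refl {point k} ⌉) , point≤ζ₊)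

  ζ₊-in-grid : grid ζ₋ ζ₊ ε ζ₊
  ζ₊-in-grid = inj₂ (⌈ ⊑-refl {ζ₊} ⌉ , ⌈ ⊑-refl {ζ₊} ⌉)

  point-zero : point zero ⊑ - ζ₋
  point-zero = ⊑-reflexive λ n →
    solve 2 (λ z e → :- z :+ con 0ℚ :* e := :- z) refl (seq ζ₋ n) (seq ε n)

  first-in-grid : grid ζ₋ ζ₊ ε (point zero)
  first-in-grid = point-in-grid zero (⊑-trans point-zero -ζ₋⊑ζ₊)

  difference-⊑ : ∀ a b c → a ⊑ b → b - c ⊑ ε → a - c ⊑ ε
  difference-⊑ a b c a⊑b b-c⊑ε = ⊑-rearrange (+-mono-⊑ a⊑b b-c⊑ε) λ n →
    solve 4 (λ a b c e → e :- (a :- c) := b :+ e :- (a :+ (b :- c))) refl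
      (seq a n) (seq b n) (seq c n) (seq ε n)

  self-difference-⊑ : ∀ a → a - a ⊑ ε
  self-difference-⊑ a = ⊑-rearrange 0⊑ε λ n →
    solve 2 (λ a e → e :- (a :- a) := e :- con 0ℚ) refl (seq a n) (seq ε n)

  -- The archimedean property gives a point of the progression above `R`. Descending from it one
  -- index at a time, the search stops when the next lower point is below `R`, or at index 0.
  brackets : Brackets (interval ζ₋ ζ₊) (grid ζ₋ ζ₊ ε) ε
  brackets {R} {a} {b} (-ζ₋≤R , R≤ζ₊) use =
    let k , ζ₋+R⊑kε = archimedean {ζ₋ + R} {ε} 0<ε
    in descend k (⊑-rearrange ζ₋+R⊑kε λ n →
         solve 4 (λ z R k e → :- z :+ k :* e :- R := k :* e :- (z :+ R)) refl
           (seq ζ₋ n) (seq R n) (seq (fromℕ k) n) (seq ε n))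
    where
    above : ∀ k → R ⊑ point (suc k) → point k ⊑ R → a ⊑ b
    above k R⊑next point⊑R = ⊑-cases {point (suc k)} {ζ₊} {a} {b}
      (λ next⊑ζ₊ → use (point k) (point (suc k)) point∈ (point-in-grid (suc k) next⊑ζ₊)
        point⊑R R⊑next (point-suc k))
      -- The progression overshoots the interval here, so the right endpoint closes the last,
      -- shorter gap.
      (λ ζ₊<next → use (point k) ζ₊ point∈ ζ₊-in-grid point⊑R ⌊ R≤ζ₊ ⌋
        (difference-⊑ ζ₊ (point (suc k)) (point k)
          (<⇒⊑ {ζ₊} {point (suc k)} ζ₊<next) (point-suc k)))
      where
      point∈ : grid ζ₋ ζ₊ ε (point k)
      point∈ = point-in-grid k (⊑-trans {point k} {R} {ζ₊} point⊑R ⌊ R≤ζ₊ ⌋)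

    descend : ∀ k → R ⊑ point k → a ⊑ b
    -- `R` lies between `- ζ₋` and the first point, which coincide, so the bracket degenerates to
    -- that one point.
    descend zero R⊑point = use (point zero) (point zero) first-in-grid first-in-grid
      (⊑-trans { point zero} { - ζ₋} {R} point-zero ⌊ -ζ₋≤R ⌋) R⊑point
      (self-difference-⊑ (point zero))
    descend (suc k) R⊑point = ⊑-cases {R} {point k} {a} {b} (descend k) λ point<R →
      above k R⊑point (<⇒⊑ {point k} {R} point<R)

-- The step size

0<1 : 0ℝ < 1ℝ
0<1 = 1ℚ , ℚₚ.positive⁻¹ 1ℚ , 0 , λ _ _ → ℚₚ.≤-refl

-- A witness for the positivity of `y` is passed only to a proof of a stable inequality, so refuting
-- `y ⊑ 0ℝ` is enough.
pos-factor : ∀ x y → 0ℝ < x → 0ℝ < x * y → ∀ {a b} → (0ℝ < y → a ⊑ b) → a ⊑ b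
pos-factor x y 0<x 0<xy {a} {b} use = ⊑-cases {y} {0ℝ} {a} {b}
  (λ y⊑0 → contradiction 0<xy (⊑⇒≯ {x * y} {0ℝ} (xy⊑0 y⊑0))) use
  where
  xy⊑0 : y ⊑ 0ℝ → x * y ⊑ 0ℝ
  xy⊑0 y⊑0 = ⊑-rearrange (*-monoʳ-⊑ {y} {0ℝ} {x} (<⇒⊑ {0ℝ} {x} 0<x) y⊑0) λ n →
    solve 2 (λ x y → con 0ℚ :- x :* y := x :* con 0ℚ :- x :* y) refl (seq x n) (seq y n)

<-⊑-trans : ∀ x y z → x < y → y ⊑ z → x < z
<-⊑-trans x y z (η , 0<η , M , x<y) ⌊ y≤z ⌋ =
  let N , y≤z′ = y≤z (½ ℚ.* η) (0<½* 0<η)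
  in ½ ℚ.* η , 0<½* 0<η , M ℕ.⊔ N , λ n n≥ → ≤-rearrange
       (ℚₚ.+-mono-≤ (x<y n (ℕₚ.m⊔n≤o⇒m≤o M N n≥)) (y≤z′ n (ℕₚ.m⊔n≤o⇒n≤o M N n≥)))
       (solve 4 (λ x y z e → z :- (x :+ con ½ :* e) := y :+ (z :+ con ½ :* e) :- (x :+ e :+ y)) refl
         (seq x n) (seq y n) (seq z n) η)

module StepSize (τ : ℕ) .{{_ : NonZero τ}} (L δ : ℝ) (0<L : 0ℝ < L) (0<δ : 0ℝ < δ) where

  ε : ℝ
  ε = stepSize 1ℝ δ L 0<L τ

  0<denominator : 0ℝ < (L * L) * (fromℕ τ * fromℕ τ)
  0<denominator = *-pos {L * L} {fromℕ τ * fromℕ τ} (*-pos {L} {L} 0<L 0<L)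
    (*-pos {fromℕ τ} {fromℕ τ} (fromℕ-pos τ) (fromℕ-pos τ))

  denominator*ε : ((L * L) * (fromℕ τ * fromℕ τ) * ε ⊑ 1ℝ * (δ * δ)) ×
                  (1ℝ * (δ * δ) ⊑ (L * L) * (fromℕ τ * fromℕ τ) * ε)
  denominator*ε = *-recip ((L * L) * (fromℕ τ * fromℕ τ)) (1ℝ * (δ * δ)) ε
    0<denominator λ _ → refl

  with-0<ε : ∀ {a b} → (0ℝ < ε → a ⊑ b) → a ⊑ b
  with-0<ε = pos-factor ((L * L) * (fromℕ τ * fromℕ τ)) ε 0<denominator
    (<-⊑-trans 0ℝ (1ℝ * (δ * δ)) ((L * L) * (fromℕ τ * fromℕ τ) * ε)
      (*-pos {1ℝ} {δ * δ} 0<1 (*-pos {δ} {δ} 0<δ 0<δ)) (proj₂ denominator*ε))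

  total-error : δ ⊑ L → fromℕ τ * (L * ε) ⊑ δ
  -- After multiplication by `L * fromℕ τ` the left side is the denominator of the step size times
  -- `ε`, that is `δ * δ`. It remains to see `δ ⊑ L * fromℕ τ`, which follows from `δ ⊑ L` and `τ`
  -- being at least 1.
  total-error δ⊑L = *-cancelˡ-⊑ {fromℕ τ * (L * ε)} {δ} {L * fromℕ τ} (*-pos {L} {fromℕ τ} 0<L (fromℕ-pos τ)) (⊑-trans (⊑-trans lhs (proj₁ denominator*ε)) rhs)
    where
    0⊑L : 0ℝ ⊑ L
    0⊑L = <⇒⊑ {0ℝ} {L} 0<L
    0⊑δ : 0ℝ ⊑ δ
    0⊑δ = <⇒⊑ {0ℝ} {δ} 0<δ
    lhs : (L * fromℕ τ) * (fromℕ τ * (L * ε)) ⊑ (L * L) * (fromℕ τ * fromℕ τ) * ε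
    lhs = ⊑-reflexive λ n → solve 3 (λ l t e → l :* t :* (t :* (l :* e)) := (l :* l) :* (t :* t) :* e) refl
      (seq L n) (seq (fromℕ τ) n) (seq ε n)
    δ⊑Lτ : δ ⊑ L * fromℕ τ
    δ⊑Lτ = ⊑-rearrange (+-mono-⊑ δ⊑L (*-monoʳ-⊑ {1ℝ} {fromℕ τ} {L} 0⊑L (1⊑fromℕ τ))) λ n →
      solve 3 (λ d l t → l :* t :- d := l :+ l :* t :- (d :+ l :* con 1ℚ)) refl
        (seq δ n) (seq L n) (seq (fromℕ τ) n)
    rhs : 1ℝ * (δ * δ) ⊑ (L * fromℕ τ) * δ
    rhs = ⊑-rearrange (*-monoʳ-⊑ {δ} {L * fromℕ τ} {δ} 0⊑δ δ⊑Lτ) λ n →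
      solve 2 (λ d l → l :* d :- con 1ℚ :* (d :* d) := d :* l :- d :* d) refl
        (seq δ n) (seq (L * fromℕ τ) n)

-- The two bounds for the step size with constant 1

module Bounds (τ : ℕ) .{{_ : NonZero τ}} (ζ₋ ζ₊ : ℝ)
  (0<ζ₋ : 0ℝ < ζ₋) (0<ζ₊ : 0ℝ < ζ₊) (ζ₋≤1 : ζ₋ ≤ 1ℝ)
  (g : ℝ → ℝ) (L : ℝ) (0<L : 0ℝ < L)
  (mono : Monotone g) (g0≈0 : g 0ℝ ≈ 0ℝ) (lip : LipschitzWith L g)
  (δ S₀ : ℝ) (0<δ : 0ℝ < δ) (0≤S₀ : 0ℝ ≤ S₀) (G Ĝ : ℕ → ℝ → ℝ)
  (prices : IsTreeApproximation τ (interval ζ₋ ζ₊) g G)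
  (pricesˆ : IsTreeApproximation τ (grid ζ₋ ζ₊ (stepSize 1ℝ δ L 0<L τ)) g Ĝ) where

  open StepSize τ L δ 0<L 0<δ

  0⊑S₀ : 0ℝ ⊑ S₀
  0⊑S₀ = ⌊ 0≤S₀ ⌋

  lip⊑ : Lipschitz L g
  lip⊑ = lipschitzWith⇒lipschitz {L} {g} (<⇒⊑ {0ℝ} {L} 0<L) lip

  0⊑g : ∀ {x} → 0ℝ ⊑ x → 0ℝ ⊑ g x
  0⊑g {x} 0⊑x = ⊑-trans {0ℝ} {g 0ℝ} {g x} ⌊ proj₂ g0≈0 ⌋ ⌊ mono 0ℝ x ⌈ 0⊑x ⌉ ⌋

  g⊑L : ∀ {x} → 0ℝ ⊑ x → g x ⊑ L * x
  g⊑L {x} 0⊑x = ⊑-rearrange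
    (+-mono-⊑ (lip⊑ x 0ℝ x
        (⊑-reflexive λ n → solve 1 (λ x → x :- con 0ℚ := x) refl (seq x n))
        (⊑-rearrange (+-mono-⊑ 0⊑x 0⊑x) λ n →
          solve 1 (λ x → x :- (con 0ℚ :- x) := x :+ x :- (con 0ℚ :+ con 0ℚ)) refl (seq x n)))
      g0⊑0) λ n →
    solve 4 (λ a z l x → l :* x :- a := z :+ l :* x :+ con 0ℚ :- (a :+ z)) refl
      (seq (g x) n) (seq (g 0ℝ) n) (seq L n) (seq x n)
    where
    g0⊑0 : g 0ℝ ⊑ 0ℝ
    g0⊑0 = ⌊ proj₁ g0≈0 ⌋

  module Positive (0<ε : 0ℝ < ε) where

    open Grid ζ₋ ζ₊ ε 0<ζ₋ 0<ζ₊ ζ₋≤1 0<ε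
    module U = Superhedging τ (interval ζ₋ ζ₊) g G prices
    module Û = Superhedging τ (grid ζ₋ ζ₊ ε) g Ĝ pricesˆ
    open Comparison τ (interval ζ₋ ζ₊) (grid ζ₋ ζ₊ ε) g G Ĝ grid⊆interval prices pricesˆ

    upper : Ĝ 0 S₀ ⊑ G 0 S₀
    upper = restriction-⊑ S₀

    0⊑Ĝ : 0ℝ ⊑ Ĝ 0 S₀
    0⊑Ĝ = Û.price-nonneg {point zero} {ζ₊} (λ r r∈ → interval≥-1 r (grid⊆interval r r∈))
      first-in-grid ζ₊-in-grid (⊑-trans point-zero -ζ₋⊑0) 0⊑ζ₊ 0⊑g 0⊑S₀

    lower : G 0 S₀ - δ * S₀ ⊑ Ĝ 0 S₀
    -- The order of `δ` and `L` is undecidable, but the goal is a stable inequality, so both cases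
    -- may be assumed in turn.
    lower = ⊑-cases {δ} {L} small large
      where
      small : δ ⊑ L → G 0 S₀ - δ * S₀ ⊑ Ĝ 0 S₀
      small δ⊑L = ⊑-rearrange
        (+-mono-⊑ (discretisation-error {L} {ε} interval≥-1 brackets lip⊑ 0⊑S₀)
          (*-monoʳ-⊑ {fromℕ τ * (L * ε)} {δ} {S₀} 0⊑S₀ (total-error δ⊑L))) λ n →
        solve 5 (λ a b k d s → b :- (a :- d :* s) := b :+ k :* s :+ s :* d :- (a :+ s :* k)) refl
          (seq (G 0 S₀) n) (seq (Ĝ 0 S₀) n) (seq (fromℕ τ * (L * ε)) n) (seq δ n) (seq S₀ n)
      large : L < δ → G 0 S₀ - δ * S₀ ⊑ Ĝ 0 S₀
      large L<δ = ⊑-rearrange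
        (+-mono-⊑ (+-mono-⊑ (U.linear-bound {L} interval≥-1 g⊑L 0⊑S₀) 0⊑Ĝ)
          (*-monoʳ-⊑ {L} {δ} {S₀} 0⊑S₀ (<⇒⊑ {L} {δ} L<δ))) λ n →
        solve 5 (λ a b l d s → b :- (a :- d :* s) := l :* s :+ b :+ s :* d :- (a :+ con 0ℚ :+ s :* l)) refl
          (seq (G 0 S₀) n) (seq (Ĝ 0 S₀) n) (seq L n) (seq δ n) (seq S₀ n)

  bounds : (G 0 S₀ - δ * S₀ ⊑ Ĝ 0 S₀) × (Ĝ 0 S₀ ⊑ G 0 S₀)
  bounds = with-0<ε Positive.lower , with-0<ε Positive.upper

corollary4p4 :
    ∃[ c ] (0ℝ < c) ×
      ((τ : ℕ) .{{_ : NonZero τ}} (Z₋ Z₊ : List ℝ) →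
       let ζ₋ = evalPoly Z₋ (fromℕ τ)
           ζ₊ = evalPoly Z₊ (fromℕ τ)
       in
       0ℝ < ζ₋ → 0ℝ < ζ₊ → ζ₋ ≤ 1ℝ →
       (g : ℝ → ℝ) (L : ℝ) (0<L : 0ℝ < L) →
       Monotone g → g 0ℝ ≈ 0ℝ → LipschitzWith L g →
       (δ S₀ : ℝ) → 0ℝ < δ → 0ℝ ≤ S₀ →
       (G Ĝ : ℕ → ℝ → ℝ) →
       IsValueFunction τ (interval ζ₋ ζ₊) g G →
       IsTreeApproximation τ (grid ζ₋ ζ₊ (stepSize c δ L 0<L τ)) g Ĝ →
       (G 0 S₀ - δ * S₀ ≤ Ĝ 0 S₀) × (Ĝ 0 S₀ ≤ G 0 S₀))
corollary4p4 = 1ℝ , 0<1 ,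
  λ τ Z₋ Z₊ 0<ζ₋ 0<ζ₊ ζ₋≤1 g L 0<L mono g0≈0 lip δ S₀ 0<δ 0≤S₀ G Ĝ exact tree →
    let ζ₋ = evalPoly Z₋ (fromℕ τ)
        ζ₊ = evalPoly Z₊ (fromℕ τ)
        lower , upper = Bounds.bounds τ ζ₋ ζ₊ 0<ζ₋ 0<ζ₊ ζ₋≤1 g L 0<L mono g0≈0 lip δ S₀ 0<δ 0≤S₀ G Ĝ
          (valueFunction⇒tree {τ} {interval ζ₋ ζ₊} {g} {G} exact) tree
    in ⌈ lower ⌉ , ⌈ upper ⌉
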